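{- The class of $(\mbox{diamond},P_1+2P_2)$-free graphs has bounded clique-width.
   Context: All graphs are finite, undirected, without multiple edges or self-loops. The diamond is the graph obtained from $K_4$ by removing one edge. $P_1+2P_2$ is the disjoint union of one isolated vertex and two single edges (five vertices). A graph is $(H_1,H_2)$-free if it has no induced subgraph isomorphic to $H_1$ or $H_2$. The clique-width of a graph $G$ is the minimum number of labels needed to construct $G$ using the operations: creating a new single vertex with label $i$; taking the disjoint union of two labelled graphs; joining each vertex with label $i$ to each vertex with label $j$ ($i\ne j$); renaming label $i$ to $j$. A class of graphs has bounded clique-width if there is a constant $c$ such that every graph in it has clique-width at most $c$. -}

module Defs where

open import Data.Bool using (if_then_else_)
open import Data.Fin using (Fin; zero; suc; toℕ; splitAt; _≟_)
open import Data.Nat using (ℕ; _+_; _≤_; NonZero)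
open import Data.Nat.Properties using (≤-trans; 1+n≢n) renaming (_≟_ to _≟ℕ_)
open import Data.Product using (_×_; _,_; Σ-syntax; ∃-syntax; proj₁; proj₂)
open import Data.Sum using (_⊎_; inj₁; inj₂; [_,_]′; swap)
open import Data.Sum.Relation.Binary.Pointwise
  using (Pointwise; inj₁; inj₂; ⊎-symmetric; ⊎-decidable)
open import Function using (_∘_; _⇔_; _↔_; Inverse; Injective; mk⇔)
open import Level using (0ℓ)
open import Relation.Binary using (Rel; Symmetric; Decidable)
open import Relation.Binary.PropositionalEquality using (_≡_; _≢_; refl; sym)
open import Relation.Nullary using (¬_; does)
open import Relation.Nullary.Decidable using (_×-dec_; _⊎-dec_; ¬?)

-- Adjacency is a decidable relation, as it is for any explicitly given
-- finite graph.
record Graph (n : ℕ) : Set₁ where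
  field
    Adj       : Rel (Fin n) 0ℓ
    adj-sym   : Symmetric Adj
    adj-irr   : ∀ {v} → ¬ Adj v v
    adj?      : Decidable Adj

open Graph public

infix 4 _≅_ _⊑_

_≅_ : ∀ {m n} → Graph m → Graph n → Set
_≅_ {m} {n} G H =
  Σ[ f ∈ Fin m ↔ Fin n ]
    (∀ u v → Adj G u v ⇔ Adj H (Inverse.to f u) (Inverse.to f v))

-- H ⊑ G: H is isomorphic to an induced subgraph of G, namely the one
-- on the image of f.
_⊑_ : ∀ {m n} → Graph m → Graph n → Set
_⊑_ {m} {n} H G =
  Σ[ f ∈ (Fin m → Fin n) ]
    (Injective _≡_ _≡_ f × (∀ u v → Adj H u v ⇔ Adj G (f u) (f v)))

GraphClass : Set₁
GraphClass = ∀ {n} → Graph n → Set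

⟨_,_⟩-Free : ∀ {a b n} → Graph a → Graph b → Graph n → Set
⟨ H₁ , H₂ ⟩-Free G = ¬ (H₁ ⊑ G) × ¬ (H₂ ⊑ G)

complete : ∀ n → Graph n
complete n = record
  { Adj     = _≢_
  ; adj-sym = λ u≢v → u≢v ∘ sym
  ; adj-irr = λ v≢v → v≢v refl
  ; adj?    = λ u v → ¬? (u ≟ v)
  }

path : ∀ n → Graph n
path n = record
  { Adj     = λ u v → toℕ v ≡ 1 + toℕ u ⊎ toℕ u ≡ 1 + toℕ v
  ; adj-sym = swap
  ; adj-irr = [ 1+n≢n ∘ sym , 1+n≢n ∘ sym ]′
  ; adj?    = λ u v → (toℕ v ≟ℕ 1 + toℕ u) ⊎-dec (toℕ u ≟ℕ 1 + toℕ v)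
  }

-- The two orientations of the (possibly absent) edge between a and b.
Between : ∀ {n} → Fin n → Fin n → Rel (Fin n) 0ℓ
Between a b u v = (u ≡ a × v ≡ b) ⊎ (u ≡ b × v ≡ a)

removeEdge : ∀ {n} → Graph n → Fin n → Fin n → Graph n
removeEdge G a b = record
  { Adj     = λ u v → Adj G u v × ¬ Between a b u v
  ; adj-sym = λ (p , ¬q) → adj-sym G p , ¬q ∘ between-sym
  ; adj-irr = adj-irr G ∘ proj₁
  ; adj?    = λ u v → adj? G u v ×-dec
                      ¬? ((u ≟ a ×-dec v ≟ b) ⊎-dec (u ≟ b ×-dec v ≟ a))
  }
  where
  between-sym : Symmetric (Between a b)
  between-sym (inj₁ (p , q)) = inj₂ (q , p)
  between-sym (inj₂ (p , q)) = inj₁ (q , p)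

infixr 6 _⊕_

_⊕_ : ∀ {m n} → Graph m → Graph n → Graph (m + n)
_⊕_ {m} G H = record
  { Adj     = λ u v → Pointwise (Adj G) (Adj H) (splitAt m u) (splitAt m v)
  ; adj-sym = ⊎-symmetric (adj-sym G) (adj-sym H)
  ; adj-irr = λ {v} → irr (splitAt m v)
  ; adj?    = λ u v → ⊎-decidable (adj? G) (adj? H) (splitAt m u) (splitAt m v)
  }
  where
  irr : ∀ x → ¬ Pointwise (Adj G) (Adj H) x x
  irr _ (inj₁ p) = adj-irr G p
  irr _ (inj₂ p) = adj-irr H p

diamond : Graph 4
diamond = removeEdge (complete 4) zero (suc zero)

P₁+2P₂ : Graph 5
P₁+2P₂ = path 1 ⊕ path 2 ⊕ path 2

record LabelledGraph (k n : ℕ) : Set₁ where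
  field
    graph : Graph n
    label : Fin n → Fin k

open LabelledGraph public

singleVertex : ∀ {k} → Fin k → LabelledGraph k 1
singleVertex i = record { graph = complete 1 ; label = λ _ → i }

disjointUnion : ∀ {k m n} → LabelledGraph k m → LabelledGraph k n →
                LabelledGraph k (m + n)
disjointUnion {m = m} L M = record
  { graph = graph L ⊕ graph M
  ; label = λ v → [ label L , label M ]′ (splitAt m v)
  }

join : ∀ {k n} (i j : Fin k) → i ≢ j → LabelledGraph k n → LabelledGraph k n
join {n = n} i j i≢j L = record
  { graph = record
    { Adj     = λ u v → Adj (graph L) u v ⊎ Between i j (ℓ u) (ℓ v)
    ; adj-sym = λ
        { (inj₁ p)              → inj₁ (adj-sym (graph L) p)
        ; (inj₂ (inj₁ (p , q))) → inj₂ (inj₂ (q , p))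
        ; (inj₂ (inj₂ (p , q))) → inj₂ (inj₁ (q , p))
        }
    ; adj-irr = irr
    ; adj?    = λ u v → adj? (graph L) u v ⊎-dec
                        ((ℓ u ≟ i ×-dec ℓ v ≟ j) ⊎-dec (ℓ u ≟ j ×-dec ℓ v ≟ i))
    }
  ; label = ℓ
  }
  where
  ℓ = label L
  both : ∀ {x} → x ≡ i → ¬ (x ≡ j)
  both refl = i≢j
  irr : ∀ {v : Fin n} → ¬ (Adj (graph L) v v ⊎ Between i j (ℓ v) (ℓ v))
  irr (inj₁ p)              = adj-irr (graph L) p
  irr (inj₂ (inj₁ (p , q))) = both p q
  irr (inj₂ (inj₂ (p , q))) = both q p

relabel : ∀ {k n} (i j : Fin k) → LabelledGraph k n → LabelledGraph k n
relabel i j L = record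
  { graph = graph L
  ; label = λ v → if does (label L v ≟ i) then j else label L v
  }

data Constructible {k : ℕ} : ∀ {n} → LabelledGraph k n → Set₁ where
  single  : ∀ i → Constructible (singleVertex i)
  union   : ∀ {m n} {L : LabelledGraph k m} {M : LabelledGraph k n} →
            Constructible L → Constructible M →
            Constructible (disjointUnion L M)
  joined  : ∀ {n} {L : LabelledGraph k n} i j (i≢j : i ≢ j) →
            Constructible L → Constructible (join i j i≢j L)
  renamed : ∀ {n} {L : LabelledGraph k n} i j →
            Constructible L → Constructible (relabel i j L)

ConstructibleWith : ∀ {n} → ℕ → Graph n → Set₁
ConstructibleWith k G =
  ∃[ n ] Σ[ L ∈ LabelledGraph k n ] (Constructible L × G ≅ graph L)

IsCliqueWidth : ∀ {n} → Graph n → ℕ → Set₁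
IsCliqueWidth G k =
  ConstructibleWith k G × (∀ j → ConstructibleWith j G → k ≤ j)

-- "The minimum is at most c", stated so that the minimum need not be
-- computed; cliqueWidth≤⇔ relates it to IsCliqueWidth.
CliqueWidth≤ : ∀ {n} → Graph n → ℕ → Set₁
CliqueWidth≤ G c = ∃[ k ] (k ≤ c × ConstructibleWith k G)

cliqueWidth≤⇔ : ∀ {n k c} (G : Graph n) → IsCliqueWidth G k →
                CliqueWidth≤ G c ⇔ k ≤ c
cliqueWidth≤⇔ G (con , least) = mk⇔
  (λ (j , j≤c , con′) → ≤-trans (least j con′) j≤c)
  (λ k≤c → _ , k≤c , con)

-- Graphs are required to have a vertex here: no sequence of the four
-- operations produces the graph without vertices.
BoundedCliqueWidth : GraphClass → Set₁
BoundedCliqueWidth C =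
  ∃[ c ] (∀ {n} .{{_ : NonZero n}} (G : Graph n) → C G → CliqueWidth≤ G c)

{-# OPTIONS --safe #-}

-- A vertex set is built up by repeatedly uniting two disjoint sets between which
-- adjacency depends only on the types of the endpoints, for a bounded number of types
-- (NLC-width); each such union costs twice as many labels in a clique-width expression.
-- Deleting a bounded number of vertices is harmless, since the adjacencies to the
-- deleted vertices can be recorded in the types.
--
-- In a diamond-free graph a vertex outside a maximal clique K, |K| ≥ 3, has at most one
-- neighbour in K.  If |K| ≥ 5, then G - K is (P₁ + P₂)-free, hence edgeless, complete or
-- complete bipartite, and G splits into blocks, one for each vertex of K.  If |K| = 4,
-- the same holds for the vertices missing two given vertices of K, and two vertices
-- always miss a common pair.  If |K| = 3, only three independent sets A, B, C remain,
-- pairwise inducing 2P₂-free bipartite graphs.  Orient A-B, B-C and C-A forwards along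
-- edges and backwards along non-edges.  An independent transversal triple makes adjacency
-- depend on boundedly many types; otherwise the only directed cycles come from triangles,
-- and the graph is built along the resulting linear order.
--
-- A triangle-free graph with a 5-cycle splits in the same way according to the
-- neighbourhoods on the cycle, up to five blocks of the above oriented kind.  Without
-- triangles and 5-cycles, G is a blown-up 7-cycle or bipartite, and the bipartite
-- complement of a bipartite (P₁ + 2P₂)-free graph is a disjoint union of chain graphs.

module Submission where

open import Defs
open import Data.Bool using (Bool; true; false; not; _∨_; _∧_; _xor_; if_then_else_)
  renaming (_≟_ to _≟ᵇ_)
open import Data.Bool.Properties using (∨-zeroʳ; ∧-zeroʳ; not-injective; ¬-not; xor-same)
open import Data.Empty using (⊥; ⊥-elim)
open import Data.Fin
  using (Fin; zero; suc; toℕ; fromℕ<; _↑ˡ_; _↑ʳ_; splitAt; combine; remQuot; _≟_)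
  renaming (join to joinFin)
open import Data.Fin.Patterns using (0F; 1F; 2F; 3F; 4F)
open import Data.Fin.Properties
  using (any?; all?; toℕ<n; toℕ-injective; toℕ-fromℕ<; splitAt-↑ˡ; splitAt-↑ʳ; join-splitAt;
         ↑ˡ-injective; ↑ʳ-injective; remQuot-combine)
open import Data.List using (List; []; _∷_; map; filter; foldl; length; allFin; cartesianProduct)
open import Data.List.Membership.Propositional using (_∈_; lose; find)
open import Data.List.Membership.Propositional.Properties
  using (∈-allFin; ∈-filter⁺; ∈-filter⁻; ∈-cartesianProduct⁺)
open import Data.List.Properties using (filter-notAll)
open import Data.List.Relation.Unary.Any using (here; there) renaming (any? to anyₗ?)
open import Data.Nat using (ℕ; zero; suc; _+_; _^_; _<_; _≤_; _<?_)
open import Data.Nat.Induction using (<-wellFounded)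
open import Data.Nat.Properties
  using (n≮0; m<1+n⇒m<n∨m≡n; m<n⇒m<1+n; n<1+n; <-irrefl; +-suc; +-mono-≤; ^-monoʳ-≤; ≤ᵇ⇒≤)
open import Data.Product using (_×_; _,_; ∃; proj₁; proj₂)
open import Data.Sum using (_⊎_; inj₁; inj₂; [_,_]′)
open import Data.Sum.Relation.Binary.Pointwise using (Pointwise)
  renaming (inj₁ to both₁; inj₂ to both₂)
open import Data.Unit using (⊤; tt)
open import Data.Vec using (Vec; []; _∷_; head; tail; lookup; zipWith; foldr′) renaming (map to mapᵥ)
open import Data.Vec.Properties using (≡-dec)
open import Data.Vec.Relation.Unary.All using (All; []; _∷_)
  renaming (map to mapₐ; all? to allᵥ?)
open import Data.Vec.Relation.Unary.AllPairs using (AllPairs; []; _∷_)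
open import Function using (_∘_; id; _⇔_; mk⇔; mk↔ₛ′; Equivalence; Injective)
open import Induction.WellFounded using (Acc; acc)
open import Relation.Binary.PropositionalEquality
  using (_≡_; _≢_; refl; sym; trans; cong; cong₂; subst; subst₂)
open import Relation.Nullary using (¬_; Dec; yes; no; does)
open import Relation.Nullary.Decidable using (¬?; _×-dec_; _⊎-dec_; dec-true; dec-false; from-yes)

-- From type-determined unions to clique-width expressions

-- The size of the clique K matters through a count. An edge uv, a vertex w missing u and v, and an
-- edge of K missed by all three form P₁ + 2P₂, and each vertex outside K spoils at most one vertex
-- of K. Five vertices of K leave two for any u, v, w. Four leave two only for a pair u, v; which
-- two varies with the pair, so the types must let it be chosen. With three, a pair attached to
-- different vertices of K leaves none, and those pairs need the cyclic orientation.
--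
-- The point of the orientation: if all arcs between P and Q lead from P to Q, adjacency depends on
-- the parts alone. Nesting of unbounded depth is thus stored in the order of the unions and costs
-- three types. Hence the types can stay fixed during the whole construction, and most of them are
-- adjacency vectors to a bounded list of reference vertices. The longest list has 15 entries, for a
-- triangle with an independent transversal triple: three for the triangle, three for its pairs of
-- vertices, three for the triple and six for the deleted vertices.

module _ {n : ℕ} (e : Fin n → Fin n → Bool) where

  -- Vertex sets are predicates, so inclusions stand in for equalities of sets. `empty` is present
  -- because a piece of a case-driven splitting may be void.
  data Built {T : Set} (τ : Fin n → T) : (Fin n → Set) → Set₁ where
    empty : ∀ {S} → (∀ {v} → ¬ S v) → Built τ S
    point : ∀ {S} v → S v → (∀ {u} → S u → u ≡ v) → Built τ S
    glue  : ∀ {S P Q} (M : T → T → Bool) →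
            (∀ {v} → S v → P v ⊎ Q v) → (∀ {v} → P v → S v) → (∀ {v} → Q v → S v) →
            (∀ {u v} → P u → Q v → u ≢ v × e u v ≡ M (τ u) (τ v)) →
            Built τ P → Built τ Q → Built τ S

moveLabel : ∀ {k} → Fin k → Fin k × Fin k → Fin k
moveLabel x (i , j) = if does (x ≟ i) then j else x

relabelAll : ∀ {k n} → List (Fin k × Fin k) → LabelledGraph k n → LabelledGraph k n
relabelAll []             L = L
relabelAll ((i , j) ∷ ps) L = relabelAll ps (relabel i j L)

module _ {k n : ℕ} where

  relabelAll-constructible : ∀ ps {L : LabelledGraph k n} → Constructible L →
                             Constructible (relabelAll ps L)
  relabelAll-constructible []             c = c
  relabelAll-constructible ((i , j) ∷ ps) c = relabelAll-constructible ps (renamed i j c)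

  relabelAll-graph : ∀ ps (L : LabelledGraph k n) → graph (relabelAll ps L) ≡ graph L
  relabelAll-graph []             L = refl
  relabelAll-graph ((i , j) ∷ ps) L = relabelAll-graph ps (relabel i j L)

  relabelAll-label : ∀ ps (L : LabelledGraph k n) v →
                     label (relabelAll ps L) v ≡ foldl moveLabel (label L v) ps
  relabelAll-label []             L v = refl
  relabelAll-label ((i , j) ∷ ps) L v = relabelAll-label ps (relabel i j L) v

module _ {j k : ℕ} (p q : Fin j → Fin k) (p≢q : ∀ a b → p a ≢ q b) where

  -- Sources and targets are disjoint, so renaming one label after another acts as a simultaneous
  -- renaming.
  moves : List (Fin j) → List (Fin k × Fin k)
  moves = map (λ a → p a , q a)

  moves-fix : ∀ as a → foldl moveLabel (q a) (moves as) ≡ q a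
  moves-fix []       a = refl
  moves-fix (b ∷ as) a rewrite dec-false (q a ≟ p b) (p≢q b a ∘ sym) = moves-fix as a

  moves-move : Injective _≡_ _≡_ p → ∀ {as a} → a ∈ as →
               foldl moveLabel (p a) (moves as) ≡ q a
  moves-move p-inj {b ∷ as} {a} a∈as with p a ≟ p b
  ... | yes eq rewrite p-inj eq = moves-fix as b
  moves-move p-inj {b ∷ as} {a} (here a≡b)   | no neq = ⊥-elim (neq (cong p a≡b))
  moves-move p-inj {b ∷ as} {a} (there a∈as) | no neq = moves-move p-inj a∈as

module _ {k j : ℕ} (p q : Fin j → Fin k) (p≢q : ∀ a b → p a ≢ q b) where

  joinAll : ∀ {n} → List (Fin j × Fin j) → LabelledGraph k n → LabelledGraph k n
  joinAll []             L = L
  joinAll ((a , b) ∷ ps) L = joinAll ps (join (p a) (q b) (p≢q a b) L)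

  module _ {n : ℕ} where

    joinAll-constructible : ∀ ps {L : LabelledGraph k n} → Constructible L →
                            Constructible (joinAll ps L)
    joinAll-constructible []             c = c
    joinAll-constructible ((a , b) ∷ ps) c =
      joinAll-constructible ps (joined (p a) (q b) (p≢q a b) c)

    joinAll-label : ∀ ps (L : LabelledGraph k n) v → label (joinAll ps L) v ≡ label L v
    joinAll-label []             L v = refl
    joinAll-label ((a , b) ∷ ps) L v = joinAll-label ps (join (p a) (q b) (p≢q a b) L) v

    -- Joins never alter labels, so the effect of the whole sequence can be read off the initial
    -- ones.
    Joined : List (Fin j × Fin j) → Fin k → Fin k → Set
    Joined ps x y = ∃ λ a → ∃ λ b → (a , b) ∈ ps × Between (p a) (q b) x y

    joinAll⁺ : ∀ ps (L : LabelledGraph k n) {u v} →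
               Adj (graph L) u v ⊎ Joined ps (label L u) (label L v) →
               Adj (graph (joinAll ps L)) u v
    joinAll⁺ []             L (inj₁ x) = x
    joinAll⁺ []             L (inj₂ (_ , _ , () , _))
    joinAll⁺ ((a , b) ∷ ps) L (inj₁ x) = joinAll⁺ ps _ (inj₁ (inj₁ x))
    joinAll⁺ ((a , b) ∷ ps) L (inj₂ (_ , _ , here refl , x)) = joinAll⁺ ps _ (inj₁ (inj₂ x))
    joinAll⁺ ((a , b) ∷ ps) L (inj₂ (c , d , there i , x)) = joinAll⁺ ps _ (inj₂ (c , d , i , x))

    joinAll⁻ : ∀ ps (L : LabelledGraph k n) {u v} →
               Adj (graph (joinAll ps L)) u v →
               Adj (graph L) u v ⊎ Joined ps (label L u) (label L v)
    joinAll⁻ []             L x = inj₁ x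
    joinAll⁻ ((a , b) ∷ ps) L x with joinAll⁻ ps _ x
    ... | inj₁ (inj₁ y)          = inj₁ y
    ... | inj₁ (inj₂ y)          = inj₂ (a , b , here refl , y)
    ... | inj₂ (c , d , i , y)   = inj₂ (c , d , there i , y)

module _ {k : ℕ} where

  left right : Fin k → Fin (k + k)
  left a  = a ↑ˡ k
  right b = k ↑ʳ b

  left≢right : ∀ a b → left a ≢ right b
  left≢right a b eq
    with () ← trans (sym (splitAt-↑ˡ k a k)) (trans (cong (splitAt k) eq) (splitAt-↑ʳ k k b))

  right≢left : ∀ b a → right b ≢ left a
  right≢left b a = left≢right a b ∘ sym

module _ {n : ℕ} (e : Fin n → Fin n → Bool)
         (e-sym : ∀ u v → e u v ≡ e v u) (e-irr : ∀ v → e v v ≡ false) where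

  -- Between unions only the left half of the labels is in use; the right half keeps the second
  -- operand apart while the joins are made.
  record Realised {k : ℕ} (τ : Fin n → Fin k) (S : Fin n → Set) : Set₁ where
    field
      {size}        : ℕ
      graphₗ        : LabelledGraph (k + k) size
      constructible : Constructible graphₗ
      vertex        : Fin size → Fin n
      injective     : Injective _≡_ _≡_ vertex
      sound         : ∀ i → S (vertex i)
      complete′     : ∀ {v} → S v → ∃ λ i → vertex i ≡ v
      adjacent      : ∀ i j → Adj (graph graphₗ) i j ⇔ e (vertex i) (vertex j) ≡ true
      labelled      : ∀ i → label graphₗ i ≡ τ (vertex i) ↑ˡ k

  open Realised

  module _ {k : ℕ} {τ : Fin n → Fin k} where

    realised-resp : ∀ {S P} → (∀ {v} → S v → P v) → (∀ {v} → P v → S v) →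
                    Realised τ P → Realised τ S
    realised-resp S⊆P P⊆S R = record
      { graphₗ = graphₗ R ; constructible = constructible R ; vertex = vertex R
      ; injective = injective R ; sound = P⊆S ∘ sound R ; complete′ = complete′ R ∘ S⊆P
      ; adjacent = adjacent R ; labelled = labelled R }

    realised-point : ∀ {S} v → S v → (∀ {u} → S u → u ≡ v) → Realised τ S
    realised-point v Sv only = record
      { graphₗ = singleVertex (τ v ↑ˡ k) ; constructible = single _ ; vertex = λ _ → v
      ; injective = λ { {zero} {zero} _ → refl } ; sound = λ _ → Sv
      ; complete′ = λ Su → zero , sym (only Su)
      ; adjacent = λ { zero zero → mk⇔ (λ ne → ⊥-elim (ne refl))
                                       (λ eq _ → true≢false (trans (sym eq) (e-irr v))) }
      ; labelled = λ _ → refl }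
      where
      true≢false : true ≡ false → ⊥
      true≢false ()

    module _ {P Q : Fin n → Set} (M : Fin k → Fin k → Bool)
             (cross : ∀ {u v} → P u → Q v → u ≢ v × e u v ≡ M (τ u) (τ v))
             (R₁ : Realised τ P) (R₂ : Realised τ Q) where

      private
        m₁ = size R₁
        m₂ = size R₂

        pairs : List (Fin k × Fin k)
        pairs = filter (λ (a , b) → M a b ≟ᵇ true) (cartesianProduct (allFin k) (allFin k))

        -- P keeps the left copies of the labels; Q is moved to the right copies and back.
        outward inward : List (Fin (k + k) × Fin (k + k))
        outward = moves left right left≢right (allFin k)
        inward  = moves right left right≢left (allFin k)

        L₂ L₃ L₄ L₅ : LabelledGraph (k + k) _
        L₂ = relabelAll outward (graphₗ R₂)
        L₃ = disjointUnion (graphₗ R₁) L₂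
        L₄ = joinAll left right left≢right pairs L₃
        L₅ = relabelAll inward L₄

        at : Fin m₁ ⊎ Fin m₂ → Fin n
        at = [ vertex R₁ , vertex R₂ ]′

        labelAt : Fin m₁ ⊎ Fin m₂ → Fin (k + k)
        labelAt (inj₁ i) = τ (vertex R₁ i) ↑ˡ k
        labelAt (inj₂ i) = k ↑ʳ τ (vertex R₂ i)

        label-L₂ : ∀ i → label L₂ i ≡ k ↑ʳ τ (vertex R₂ i)
        label-L₂ i = trans (relabelAll-label outward (graphₗ R₂) i)
          (trans (cong (λ l → foldl moveLabel l outward) (labelled R₂ i))
                 (moves-move left right left≢right (λ {x} {y} → ↑ˡ-injective k x y) (∈-allFin _)))

        label-L₃ : ∀ x → [ label (graphₗ R₁) , label L₂ ]′ x ≡ labelAt x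
        label-L₃ (inj₁ i) = labelled R₁ i
        label-L₃ (inj₂ i) = label-L₂ i

        label-L₅ : ∀ i → label L₅ i ≡ τ (at (splitAt m₁ i)) ↑ˡ k
        label-L₅ i = trans (relabelAll-label inward L₄ i)
          (trans (cong (λ l → foldl moveLabel l inward)
                       (trans (joinAll-label left right left≢right pairs L₃ i) (label-L₃ (splitAt m₁ i))))
                 (back (splitAt m₁ i)))
          where
          back : ∀ x → foldl moveLabel (labelAt x) inward ≡ τ (at x) ↑ˡ k
          back (inj₁ i) = moves-fix right left right≢left (allFin k) _
          back (inj₂ i) = moves-move right left right≢left (λ {x} {y} → ↑ʳ-injective k x y) (∈-allFin _)

        -- Phrased over the sum type, so that matching on the two sides computes the labels.
        Adj₃ : Fin m₁ ⊎ Fin m₂ → Fin m₁ ⊎ Fin m₂ → Set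
        Adj₃ x y = Pointwise (Adj (graph (graphₗ R₁))) (Adj (graph L₂)) x y
                   ⊎ Joined left right left≢right {size R₁ + size R₂} pairs (labelAt x) (labelAt y)

        across : ∀ i j → M (τ (vertex R₁ i)) (τ (vertex R₂ j)) ≡ true ⇔
                         e (vertex R₁ i) (vertex R₂ j) ≡ true
        across i j = mk⇔ (trans eq) (trans (sym eq))
          where eq = proj₂ (cross (sound R₁ i) (sound R₂ j))

        M-pairs : ∀ {a b} → (a , b) ∈ pairs → M a b ≡ true
        M-pairs i = proj₂ (∈-filter⁻ (λ (a , b) → M a b ≟ᵇ true)
                            {xs = cartesianProduct (allFin k) (allFin k)} i)

        pairs-M : ∀ {a b} → M a b ≡ true → (a , b) ∈ pairs
        pairs-M = ∈-filter⁺ (λ (a , b) → M a b ≟ᵇ true)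
                            (∈-cartesianProduct⁺ (∈-allFin _) (∈-allFin _))

        sameˡ : {a b : Fin k} → a ↑ˡ k ≡ b ↑ˡ k → b ≡ a
        sameˡ = sym ∘ ↑ˡ-injective k _ _

        sameʳ : {a b : Fin k} → k ↑ʳ a ≡ k ↑ʳ b → b ≡ a
        sameʳ = sym ∘ ↑ʳ-injective k _ _

        Adj₃⇒e : ∀ x y → Adj₃ x y → e (at x) (at y) ≡ true
        Adj₃⇒e _ _ (inj₁ (both₁ {i} {j} a)) = Equivalence.to (adjacent R₁ i j) a
        Adj₃⇒e _ _ (inj₁ (both₂ {i} {j} a)) = Equivalence.to (adjacent R₂ i j)
          (subst (λ g → Adj g i j) (relabelAll-graph outward (graphₗ R₂)) a)
        -- A join pairs a left with a right label, hence adds nothing inside one operand.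
        Adj₃⇒e (inj₁ i) (inj₁ j) (inj₂ (a , b , ab , inj₁ (p , q))) = ⊥-elim (left≢right _ _ q)
        Adj₃⇒e (inj₁ i) (inj₁ j) (inj₂ (a , b , ab , inj₂ (p , q))) = ⊥-elim (left≢right _ _ p)
        Adj₃⇒e (inj₂ i) (inj₂ j) (inj₂ (a , b , ab , inj₁ (p , q))) = ⊥-elim (left≢right _ _ (sym p))
        Adj₃⇒e (inj₂ i) (inj₂ j) (inj₂ (a , b , ab , inj₂ (p , q))) = ⊥-elim (left≢right _ _ (sym q))
        Adj₃⇒e (inj₁ i) (inj₂ j) (inj₂ (a , b , ab , inj₂ (p , q))) = ⊥-elim (left≢right _ _ p)
        Adj₃⇒e (inj₁ i) (inj₂ j) (inj₂ (a , b , ab , inj₁ (p , q))) =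
          Equivalence.to (across i j)
            (subst₂ (λ a b → M a b ≡ true) (sameˡ p) (sameʳ q) (M-pairs ab))
        Adj₃⇒e (inj₂ i) (inj₁ j) (inj₂ (a , b , ab , inj₁ (p , q))) = ⊥-elim (left≢right _ _ (sym p))
        Adj₃⇒e (inj₂ i) (inj₁ j) (inj₂ (a , b , ab , inj₂ (p , q))) =
          trans (e-sym _ _) (Equivalence.to (across j i)
            (subst₂ (λ a b → M a b ≡ true) (sameˡ q) (sameʳ p) (M-pairs ab)))

        e⇒Adj₃ : ∀ x y → e (at x) (at y) ≡ true → Adj₃ x y
        e⇒Adj₃ (inj₁ i) (inj₁ j) eq = inj₁ (both₁ (Equivalence.from (adjacent R₁ i j) eq))
        e⇒Adj₃ (inj₂ i) (inj₂ j) eq = inj₁ (both₂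
          (subst (λ g → Adj g i j) (sym (relabelAll-graph outward (graphₗ R₂)))
            (Equivalence.from (adjacent R₂ i j) eq)))
        e⇒Adj₃ (inj₁ i) (inj₂ j) eq =
          inj₂ (_ , _ , pairs-M (Equivalence.from (across i j) eq) , inj₁ (refl , refl))
        e⇒Adj₃ (inj₂ i) (inj₁ j) eq =
          inj₂ (_ , _ , pairs-M (Equivalence.from (across j i) (trans (e-sym _ _) eq)) ,
                inj₂ (refl , refl))

        labels≡ : ∀ u → label L₃ u ≡ labelAt (splitAt m₁ u)
        labels≡ u = label-L₃ (splitAt m₁ u)

        adjacent₅ : ∀ u v → Adj (graph L₅) u v ⇔ e (at (splitAt m₁ u)) (at (splitAt m₁ v)) ≡ true
        adjacent₅ u v = mk⇔
          (λ a → Adj₃⇒e (splitAt m₁ u) (splitAt m₁ v) (relabelled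
            (joinAll⁻ left right left≢right pairs L₃
              (subst (λ g → Adj g u v) (relabelAll-graph inward L₄) a))))
          (λ eq → subst (λ g → Adj g u v) (sym (relabelAll-graph inward L₄))
            (joinAll⁺ left right left≢right pairs L₃ (unrelabelled (e⇒Adj₃ (splitAt m₁ u) (splitAt m₁ v) eq))))
          where
          relabelled : Adj (graph L₃) u v ⊎ Joined left right left≢right {size R₁ + size R₂} pairs (label L₃ u) (label L₃ v) →
                       Adj₃ (splitAt m₁ u) (splitAt m₁ v)
          relabelled (inj₁ a) = inj₁ a
          relabelled (inj₂ a) =
            inj₂ (subst₂ (Joined left right left≢right {size R₁ + size R₂} pairs) (labels≡ u) (labels≡ v) a)
          unrelabelled : Adj₃ (splitAt m₁ u) (splitAt m₁ v) →
                         Adj (graph L₃) u v ⊎ Joined left right left≢right {size R₁ + size R₂} pairs (label L₃ u) (label L₃ v)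
          unrelabelled (inj₁ a) = inj₁ a
          unrelabelled (inj₂ a) =
            inj₂ (subst₂ (Joined left right left≢right {size R₁ + size R₂} pairs) (sym (labels≡ u)) (sym (labels≡ v)) a)

        at-injective : ∀ x y → at x ≡ at y → x ≡ y
        at-injective (inj₁ i) (inj₁ j) eq = cong inj₁ (injective R₁ eq)
        at-injective (inj₂ i) (inj₂ j) eq = cong inj₂ (injective R₂ eq)
        at-injective (inj₁ i) (inj₂ j) eq = ⊥-elim (proj₁ (cross (sound R₁ i) (sound R₂ j)) eq)
        at-injective (inj₂ i) (inj₁ j) eq = ⊥-elim (proj₁ (cross (sound R₁ j) (sound R₂ i)) (sym eq))

        splitAt-injective : ∀ {u v} → splitAt m₁ {m₂} u ≡ splitAt m₁ v → u ≡ v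
        splitAt-injective {u} {v} eq =
          trans (sym (join-splitAt m₁ m₂ u)) (trans (cong (joinFin m₁ m₂) eq) (join-splitAt m₁ m₂ v))

      realised-glue : Realised τ (λ v → P v ⊎ Q v)
      realised-glue = record
        { graphₗ        = L₅
        ; constructible = relabelAll-constructible inward
            (joinAll-constructible left right left≢right pairs
              (union (constructible R₁) (relabelAll-constructible outward (constructible R₂))))
        ; vertex        = at ∘ splitAt m₁
        ; injective     = splitAt-injective ∘ at-injective _ _
        ; sound         = sound₅ ∘ splitAt m₁
        ; complete′     = complete₅
        ; adjacent      = adjacent₅
        ; labelled      = label-L₅
        }
        where
        sound₅ : ∀ x → P (at x) ⊎ Q (at x)
        sound₅ (inj₁ i) = inj₁ (sound R₁ i)
        sound₅ (inj₂ i) = inj₂ (sound R₂ i)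
        complete₅ : ∀ {v} → P v ⊎ Q v → ∃ λ i → at (splitAt m₁ i) ≡ v
        complete₅ (inj₁ Pv) with i , eq ← complete′ R₁ Pv =
          i ↑ˡ m₂ , trans (cong at (splitAt-↑ˡ m₁ i m₂)) eq
        complete₅ (inj₂ Qv) with i , eq ← complete′ R₂ Qv =
          m₁ ↑ʳ i , trans (cong at (splitAt-↑ʳ m₁ m₂ i)) eq

    -- No operation yields the graph without vertices, hence the alternative; an empty operand of
    -- `glue` is dropped.
    realise : ∀ {S} → Built e τ S → (∀ {v} → ¬ S v) ⊎ Realised τ S
    realise (empty none)        = inj₁ none
    realise (point v Sv only)   = inj₂ (realised-point v Sv only)
    realise (glue M S⊆ P⊆S Q⊆S cross bP bQ) with realise bP | realise bQ
    ... | inj₁ noP | inj₁ noQ = inj₁ ([ noP , noQ ]′ ∘ S⊆)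
    ... | inj₁ noP | inj₂ R   = inj₂ (realised-resp ([ ⊥-elim ∘ noP , id ]′ ∘ S⊆) Q⊆S R)
    ... | inj₂ R   | inj₁ noQ = inj₂ (realised-resp ([ id , ⊥-elim ∘ noQ ]′ ∘ S⊆) P⊆S R)
    ... | inj₂ R₁  | inj₂ R₂  =
      inj₂ (realised-resp S⊆ [ P⊆S , Q⊆S ]′ (realised-glue M cross R₁ R₂))

-- Vertex sets, blocks and deleted vertices

-- A family of vertex sets satisfying Φ as soon as all its proper subsets do.
module _ {n : ℕ} (Φ : (Fin n → Set) → Set₁)
         (step : ∀ S → (∀ P → (∀ {v} → P v → S v) → (∃ λ v → S v × ¬ P v) → Φ P) → Φ S) where

  private
    -- A predicate has no cardinality to descend on; the length of a list covering it decreases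
    -- instead.
    bounded : ∀ xs → Acc _<_ (length xs) → ∀ S → (∀ {v} → S v → v ∈ xs) → Φ S
    bounded xs (acc rs) S S⊆xs = step S λ P P⊆S (v , Sv , ¬Pv) →
      bounded (filter (¬? ∘ (v ≟_)) xs)
              (rs (filter-notAll (¬? ∘ (v ≟_)) xs (lose (S⊆xs Sv) (λ v≢v → v≢v refl)))) P
              (λ Pu → ∈-filter⁺ (¬? ∘ (v ≟_)) (S⊆xs (P⊆S Pu)) (λ { refl → ¬Pv Pu }))

  subset-induction : ∀ S → Φ S
  subset-induction S = bounded (allFin n) (<-wellFounded _) S (λ _ → ∈-allFin _)

-- The usual type of a vertex: its adjacencies to the reference vertices rs.
bits : ∀ {n m} → (Fin n → Fin n → Bool) → Vec (Fin n) m → Fin n → Vec Bool m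
bits e rs v = mapᵥ (λ r → e r v) rs

module _ {n : ℕ} {e : Fin n → Fin n → Bool} where

  built-resp : ∀ {T} {τ : Fin n → T} {S P} → (∀ {v} → S v → P v) → (∀ {v} → P v → S v) →
               Built e τ P → Built e τ S
  built-resp S⊆P P⊆S (empty none)      = empty (none ∘ S⊆P)
  built-resp S⊆P P⊆S (point v Pv only) = point v (P⊆S Pv) (only ∘ S⊆P)
  built-resp S⊆P P⊆S (glue M P⊆ A⊆P B⊆P cross bA bB) =
    glue M (P⊆ ∘ S⊆P) (P⊆S ∘ A⊆P) (P⊆S ∘ B⊆P) cross bA bB

  refine : ∀ {T T′ : Set} {τ : Fin n → T} {τ′ : Fin n → T′} {S} (f : T′ → T) →
           (∀ {v} → S v → τ v ≡ f (τ′ v)) → Built e τ S → Built e τ′ S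
  refine f eq (empty none)      = empty none
  refine f eq (point v Sv only) = point v Sv only
  refine f eq (glue M S⊆ P⊆S Q⊆S cross bP bQ) =
    glue (λ s t → M (f s) (f t)) S⊆ P⊆S Q⊆S
      (λ Pu Qv → proj₁ (cross Pu Qv) ,
                 trans (proj₂ (cross Pu Qv)) (cong₂ M (eq (P⊆S Pu)) (eq (Q⊆S Qv))))
      (refine f (eq ∘ P⊆S) bP) (refine f (eq ∘ Q⊆S) bQ)

  module _ {T : Set} {τ : Fin n → T} where

    cut : ∀ {S D : Fin n → Set} → (∀ v → Dec (D v)) → (M : T → T → Bool) →
          (∀ {u v} → S u → D u → S v → ¬ D v → e u v ≡ M (τ u) (τ v)) →
          Built e τ (λ v → S v × D v) → Built e τ (λ v → S v × ¬ D v) → Built e τ S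
    cut {S} {D} D? M cross = glue M side proj₁ proj₁
      (λ (Su , Du) (Sv , ¬Dv) → (λ { refl → ¬Dv Du }) , cross Su Du Sv ¬Dv)
      where
      side : ∀ {v} → S v → (S v × D v) ⊎ (S v × ¬ D v)
      side {v} Sv with D? v
      ... | yes Dv = inj₁ (Sv , Dv)
      ... | no ¬Dv = inj₂ (Sv , ¬Dv)

    -- The blocks are united in the order of their indices; a new block meets the earlier ones only
    -- in pairs that differ under β. The number of blocks is not bounded.
    blocks : ∀ {m} {S : Fin n → Set} (β : Fin n → Fin m) (M : T → T → Bool) →
             (∀ {u v} → S u → S v → β u ≢ β v → e u v ≡ M (τ u) (τ v)) →
             (∀ i → Built e τ (λ v → S v × β v ≡ i)) → Built e τ S
    blocks {m} {S} β M cross block =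
      built-resp (λ Sv → Sv , toℕ<n _) proj₁ (upTo m)
      where
      upTo : ∀ j → Built e τ (λ v → S v × toℕ (β v) < j)
      upTo zero    = empty (n≮0 ∘ proj₂)
      upTo (suc j) = glue M side (λ (Sv , lt) → Sv , m<n⇒m<1+n lt)
                          (λ { (Sv , refl) → Sv , n<1+n _ })
                          (λ { (Su , lt) (Sv , refl) → (λ { refl → <-irrefl refl lt }) ,
                               cross Su Sv (λ eq → <-irrefl (cong toℕ eq) lt) })
                          (upTo j) (last j)
        where
        side : ∀ {v} → S v × toℕ (β v) < suc j → (S v × toℕ (β v) < j) ⊎ (S v × toℕ (β v) ≡ j)
        side (Sv , lt) with m<1+n⇒m<n∨m≡n lt
        ... | inj₁ lt′ = inj₁ (Sv , lt′)
        ... | inj₂ eq  = inj₂ (Sv , eq)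
        last : ∀ j → Built e τ (λ v → S v × toℕ (β v) ≡ j)
        last j with j <? m
        ... | yes j<m = built-resp
          (λ (Sv , eq) → Sv , toℕ-injective (trans eq (sym (toℕ-fromℕ< j<m))))
          (λ (Sv , eq) → Sv , trans (cong toℕ eq) (toℕ-fromℕ< j<m)) (block (fromℕ< j<m))
        ... | no j≮m  = empty (λ { (_ , refl) → j≮m (toℕ<n _) })

    homogeneous : ∀ {S} → (∀ v → Dec (S v)) → (M : T → T → Bool) →
                  (∀ {u v} → S u → S v → u ≢ v → e u v ≡ M (τ u) (τ v)) → Built e τ S
    homogeneous {S} S? M cross = blocks id M cross single′
      where
      single′ : ∀ i → Built e τ (λ v → S v × v ≡ i)
      single′ i with S? i
      ... | yes Si = point i (Si , refl) proj₂
      ... | no ¬Si = empty (λ { (Si , refl) → ¬Si Si })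

  -- The new entry of the type of v is its adjacency to r, so the union with r reads the head of the
  -- second vector.
  add : ∀ {m} {rs : Vec (Fin n) m} {S} r → (∀ v → Dec (S v)) →
        Built e (bits e rs) (λ v → S v × v ≢ r) → Built e (bits e (r ∷ rs)) S
  add {S = S} r S? b with S? r
  ... | yes Sr = cut (_≟ r) (λ _ → head) (λ { _ refl _ _ → refl })
                     (point r (Sr , refl) proj₂) (refine tail (λ _ → refl) b)
  ... | no ¬Sr = built-resp (λ Sv → Sv , λ { refl → ¬Sr Sv }) proj₁ (refine tail (λ _ → refl) b)

-- Three independent sets in cyclic order

nxt : Fin 3 → Fin 3
nxt zero             = suc zero
nxt (suc zero)       = suc (suc zero)
nxt (suc (suc zero)) = zero

nxt-cycle : ∀ i → nxt (nxt (nxt i)) ≡ i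
nxt-cycle zero             = refl
nxt-cycle (suc zero)       = refl
nxt-cycle (suc (suc zero)) = refl

nxt≢ : ∀ {i} → nxt i ≢ i
nxt≢ {zero} ()
nxt≢ {suc zero} ()
nxt≢ {suc (suc zero)} ()

nxt²≢ : ∀ {i} → nxt (nxt i) ≢ i
nxt²≢ {zero} ()
nxt²≢ {suc zero} ()
nxt²≢ {suc (suc zero)} ()

trichotomy : ∀ i j → j ≡ i ⊎ j ≡ nxt i ⊎ i ≡ nxt j
trichotomy zero             zero             = inj₁ refl
trichotomy zero             (suc zero)       = inj₂ (inj₁ refl)
trichotomy zero             (suc (suc zero)) = inj₂ (inj₂ refl)
trichotomy (suc zero)       zero             = inj₂ (inj₂ refl)
trichotomy (suc zero)       (suc zero)       = inj₁ refl
trichotomy (suc zero)       (suc (suc zero)) = inj₂ (inj₁ refl)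
trichotomy (suc (suc zero)) zero             = inj₂ (inj₁ refl)
trichotomy (suc (suc zero)) (suc zero)       = inj₂ (inj₂ refl)
trichotomy (suc (suc zero)) (suc (suc zero)) = inj₁ refl

-- The adjacency encoded by an arc from part i to part j: forward arcs are edges, backward arcs are
-- non-edges.
ahead : Fin 3 → Fin 3 → Bool
ahead i j = does (j ≟ nxt i)

ahead-next : ∀ {i j} → j ≡ nxt i → ahead i j ≡ true
ahead-next {i} {j} eq = dec-true (j ≟ nxt i) eq

ahead-same : ∀ {i j} → j ≡ i → ahead i j ≡ false
ahead-same {i} refl = dec-false (i ≟ nxt i) (nxt≢ ∘ sym)

ahead-prev : ∀ {i j} → i ≡ nxt j → ahead i j ≡ false
ahead-prev {j = j} refl = dec-false (j ≟ nxt (nxt j)) (nxt²≢ ∘ sym)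

record Free (n : ℕ) : Set where
  field
    e     : Fin n → Fin n → Bool
    e-sym : ∀ u v → e u v ≡ e v u
    e-irr : ∀ v → e v v ≡ false

  _~_ : Fin n → Fin n → Set
  _~_ u v = e u v ≡ true

  _≁_ : Fin n → Fin n → Set
  _≁_ u v = e u v ≡ false

  field
    no-P₁+2P₂  : ∀ {p a b c d} → a ~ b → c ~ d → a ≁ c → a ≁ d → b ≁ c → b ≁ d →
                 p ≁ a → p ≁ b → p ≁ c → p ≁ d → ⊥
    no-diamond : ∀ {u v w z} → u ~ v → u ~ w → v ~ w → u ~ z → v ~ z → w ≢ z → w ~ z

  flip : ∀ {u v b} → e u v ≡ b → e v u ≡ b
  flip {u} {v} eq = trans (e-sym v u) eq

  _~?_ : ∀ u v → Dec (u ~ v)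
  u ~? v = e u v ≟ᵇ true

  _≁?_ : ∀ u v → Dec (u ≁ v)
  u ≁? v = e u v ≟ᵇ false

  edge? : ∀ u v → u ~ v ⊎ u ≁ v
  edge? u v with e u v
  ... | true  = inj₁ refl
  ... | false = inj₂ refl

  clash : ∀ {u v} → u ~ v → u ≁ v → ⊥
  clash u~v u≁v with () ← trans (sym u~v) u≁v

  ~⇒≢ : ∀ {u v} → u ~ v → u ≢ v
  ~⇒≢ u~v refl = clash u~v (e-irr _)

  ¬≁⇒~ : ∀ {u v} → (u ≁ v → ⊥) → u ~ v
  ¬≁⇒~ {u} {v} f with edge? u v
  ... | inj₁ u~v = u~v
  ... | inj₂ u≁v = ⊥-elim (f u≁v)

  ¬~⇒≁ : ∀ {u v} → (u ~ v → ⊥) → u ≁ v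
  ¬~⇒≁ {u} {v} f with edge? u v
  ... | inj₁ u~v = ⊥-elim (f u~v)
  ... | inj₂ u≁v = u≁v

module _ {n : ℕ} (𝒢 : Free n) where
  open Free 𝒢

  module _ (κ : Fin n → Fin 3) where

    -- In the orientation, `chains` forbids directed 4-cycles between two parts, and
    -- `no-independent` forbids the 3-cycles running backwards through the parts. The forward ones
    -- are triangles and remain possible.
    record Cyclic (S : Fin n → Set) : Set where
      field
        part-independent : ∀ {u v} → S u → S v → κ u ≡ κ v → u ≁ v
        chains           : ∀ {a a′ b b′} → S a → S a′ → S b → S b′ →
                           κ a ≡ κ a′ → κ b ≡ κ b′ → a ~ b → a′ ~ b′ → a ≁ b′ → a′ ≁ b → ⊥
        no-independent   : ∀ {u v w} → κ u ≡ zero → κ v ≡ suc zero → κ w ≡ suc (suc zero) →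
                           S u → S v → S w → u ≁ v → v ≁ w → w ≁ u → ⊥

    private
      Arc : Fin n → Fin n → Set
      Arc u v = (κ v ≡ nxt (κ u) × u ~ v) ⊎ (κ u ≡ nxt (κ v) × u ≁ v)

      arc? : ∀ u v → Dec (Arc u v)
      arc? u v = (κ v ≟ nxt (κ u) ×-dec u ~? v) ⊎-dec (κ u ≟ nxt (κ v) ×-dec u ≁? v)

      arc-or-same : ∀ u v → κ u ≡ κ v ⊎ Arc u v ⊎ Arc v u
      arc-or-same u v with trichotomy (κ u) (κ v) | edge? u v
      ... | inj₁ eq        | _        = inj₁ (sym eq)
      ... | inj₂ (inj₁ eq) | inj₁ u~v = inj₂ (inj₁ (inj₁ (eq , u~v)))
      ... | inj₂ (inj₁ eq) | inj₂ u≁v = inj₂ (inj₂ (inj₂ (eq , flip u≁v)))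
      ... | inj₂ (inj₂ eq) | inj₁ u~v = inj₂ (inj₂ (inj₁ (eq , flip u~v)))
      ... | inj₂ (inj₂ eq) | inj₂ u≁v = inj₂ (inj₁ (inj₂ (eq , u≁v)))

      arc-ahead : ∀ {u v} → Arc u v → e u v ≡ ahead (κ u) (κ v)
      arc-ahead (inj₁ (eq , u~v)) = trans u~v (sym (ahead-next eq))
      arc-ahead (inj₂ (eq , u≁v)) = trans u≁v (sym (ahead-prev eq))

      arc-part : ∀ {u v} → Arc u v → κ u ≢ κ v
      arc-part (inj₁ (eq , _)) eq′ = nxt≢ (trans (sym eq) (sym eq′))
      arc-part (inj₂ (eq , _)) eq′ = nxt≢ (trans (sym eq) eq′)

      arc-asym : ∀ {u v} → Arc u v → Arc v u → ⊥
      arc-asym (inj₁ (eq , _)) (inj₁ (eq′ , _)) = nxt²≢ (trans (sym (cong nxt eq)) (sym eq′))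
      arc-asym (inj₁ (_ , a)) (inj₂ (_ , b))    = clash a (flip b)
      arc-asym (inj₂ (_ , a)) (inj₁ (_ , b))    = clash (flip b) a
      arc-asym (inj₂ (eq , _)) (inj₂ (eq′ , _)) = nxt²≢ (trans (sym (cong nxt eq)) (sym eq′))

      not-both : ∀ {i j k} → j ≡ nxt i → k ≡ nxt j → k ≡ nxt i → ⊥
      not-both refl refl eq = nxt≢ eq

      rotate : (Ψ : Fin n → Fin n → Fin n → Set) → (∀ {u v w} → Ψ u v w → Ψ v w u) →
               (∀ {u v w} → κ u ≡ zero → κ v ≡ suc zero → κ w ≡ suc (suc zero) → Ψ u v w) →
               ∀ {u v w} → κ v ≡ nxt (κ u) → κ w ≡ nxt (κ v) → Ψ u v w
      rotate Ψ turn base {u} p q = go (κ u) refl p q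
        where
        go : ∀ i {u v w} → κ u ≡ i → κ v ≡ nxt (κ u) → κ w ≡ nxt (κ v) → Ψ u v w
        go zero p q r = base p q′ (trans r (cong nxt q′))
          where q′ = trans q (cong nxt p)
        go (suc zero) p q r = turn (base (trans r (cong nxt q′)) p q′)
          where q′ = trans q (cong nxt p)
        go (suc (suc zero)) p q r = turn (turn (base q′ (trans r (cong nxt q′)) p))
          where q′ = trans q (cong nxt p)

    module _ {S : Fin n → Set} (C : Cyclic S) where
      open Cyclic C

      no-independent′ : ∀ {u v w} → κ v ≡ nxt (κ u) → κ w ≡ nxt (κ v) →
                        S u → S v → S w → u ≁ v → v ≁ w → w ≁ u → ⊥
      no-independent′ = rotate (λ u v w → S u → S v → S w → u ≁ v → v ≁ w → w ≁ u → ⊥)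
                               (λ f a b c x y z → f c a b z x y) no-independent

      -- Being back in the part of s after two arcs forces forward and backward arcs to alternate;
      -- the four arcs then spell out an induced 2P₂ between two parts.
      acyclic₄ : ∀ {s w u v} → S s → S w → S u → S v → κ s ≡ κ u → κ w ≡ κ v →
                 Arc s w → Arc w u → Arc u v → Arc v s → ⊥
      acyclic₄ Ss Sw Su Sv su wv (inj₁ (_ , sw)) (inj₂ (_ , wu)) (inj₁ (_ , uv)) (inj₂ (_ , vs)) =
        chains Ss Su Sw Sv su wv sw uv (flip vs) (flip wu)
      acyclic₄ Ss Sw Su Sv su wv (inj₂ (_ , sw)) (inj₁ (_ , wu)) (inj₂ (_ , uv)) (inj₁ (_ , vs)) =
        chains Ss Su Sv Sw su (sym wv) (flip vs) (flip wu) sw uv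
      acyclic₄ _ _ _ _ su wv (inj₁ (p , _)) (inj₁ (q , _)) _ _ =
        nxt²≢ (trans (sym (cong nxt p)) (trans (sym q) (sym su)))
      acyclic₄ _ _ _ _ su wv (inj₂ (p , _)) (inj₂ (q , _)) _ _ =
        nxt²≢ (trans (sym (cong nxt q)) (trans (sym p) su))
      acyclic₄ _ _ _ _ su wv (inj₁ _) (inj₂ (q , _)) (inj₂ (r , _)) _ =
        nxt²≢ (trans (sym (trans q (cong nxt r))) wv)
      acyclic₄ _ _ _ _ su wv (inj₂ _) (inj₁ (q , _)) (inj₁ (r , _)) _ =
        nxt²≢ (trans (sym (trans r (cong nxt q))) (sym wv))
      acyclic₄ _ _ _ _ su wv (inj₁ (p , _)) _ _ (inj₁ (q , _)) =
        nxt²≢ (trans (sym (trans q (cong nxt (trans (sym wv) p)))) refl)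
      acyclic₄ _ _ _ _ su wv (inj₂ (p , _)) _ _ (inj₂ (q , _)) =
        nxt²≢ (trans (sym (trans p (cong nxt (trans wv q)))) refl)

      module _ (no-triangle : ∀ {u v w} → κ v ≡ nxt (κ u) → κ w ≡ nxt (κ v) →
                              S u → S v → S w → u ~ v → v ~ w → w ~ u → ⊥) where

        -- Three steps of +1 or -1 modulo 3 sum to zero only if they agree: a forward cycle is a
        -- triangle, a backward one an independent triple.
        acyclic₃ : ∀ {u v w} → S u → S v → S w → Arc u v → Arc v w → Arc w u → ⊥
        acyclic₃ Su Sv Sw (inj₁ (p , a)) (inj₁ (q , b)) (inj₁ (_ , c)) =
          no-triangle p q Su Sv Sw a b c
        acyclic₃ Su Sv Sw (inj₂ (p , a)) (inj₂ (q , b)) (inj₂ (r , c)) =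
          no-independent′ r q Su Sw Sv (flip c) (flip b) (flip a)
        acyclic₃ _ _ _ (inj₁ (p , _)) (inj₁ (q , _)) (inj₂ (r , _)) = not-both p q r
        acyclic₃ _ _ _ (inj₁ (p , _)) (inj₂ (q , _)) (inj₁ (r , _)) = not-both r p q
        acyclic₃ _ _ _ (inj₂ (p , _)) (inj₁ (q , _)) (inj₁ (r , _)) = not-both q r p
        acyclic₃ _ _ _ (inj₂ (p , _)) (inj₂ (q , _)) (inj₁ (r , _)) = not-both q p r
        acyclic₃ _ _ _ (inj₂ (p , _)) (inj₁ (q , _)) (inj₂ (r , _)) = not-both p r q
        acyclic₃ _ _ _ (inj₁ (p , _)) (inj₂ (q , _)) (inj₂ (r , _)) = not-both r q p

        -- If v precedes a source s of the rest and u precedes v, then s and u lie in the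
        -- same part, and any w preceding u closes a directed 3- or 4-cycle.
        source : ∀ x xs → (∀ {y} → y ∈ x ∷ xs → S y) →
                 ∃ λ s → s ∈ x ∷ xs × (∀ {w} → w ∈ x ∷ xs → ¬ Arc w s)
        source x []       ⊆S = x , here refl , λ { (here refl) a → arc-part a refl }
        source v (y ∷ ys) ⊆S with source y ys (⊆S ∘ there)
        ... | s , s∈ , minimal with arc? v s
        ...   | no ¬vs = s , there s∈ , λ { (here refl) → ¬vs ; (there w∈) → minimal w∈ }
        ...   | yes vs with anyₗ? (λ u → arc? u v) (y ∷ ys)
        ...     | no none = v , here refl ,
                    λ { (here refl) a → arc-part a refl ; (there w∈) a → none (lose w∈ a) }
        ...     | yes some with u , u∈ , uv ← find some =
                    u , there u∈ , λ { (here refl) vu → arc-asym uv vu ; (there w∈) → u-minimal w∈ }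
          where
          Sv = ⊆S (here refl)
          Su = ⊆S (there u∈)
          Ss = ⊆S (there s∈)
          same-part : κ s ≡ κ u
          same-part with arc-or-same s u
          ... | inj₁ eq        = eq
          ... | inj₂ (inj₁ su) = ⊥-elim (acyclic₃ Su Sv Ss uv vs su)
          ... | inj₂ (inj₂ us) = ⊥-elim (minimal u∈ us)
          u-minimal : ∀ {w} → w ∈ y ∷ ys → ¬ Arc w u
          u-minimal {w} w∈ wu with arc-or-same s w | arc-or-same w v
          ... | inj₁ sw        | _ = arc-part wu (trans (sym sw) same-part)
          ... | inj₂ (inj₂ ws) | _ = minimal w∈ ws
          ... | inj₂ (inj₁ sw) | inj₁ eq        =
                acyclic₄ Ss (⊆S (there w∈)) Su Sv same-part eq sw wu uv vs
          ... | inj₂ (inj₁ sw) | inj₂ (inj₁ wv) = acyclic₃ (⊆S (there w∈)) Sv Ss wv vs sw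
          ... | inj₂ (inj₁ sw) | inj₂ (inj₂ vw) = acyclic₃ Sv (⊆S (there w∈)) Su vw wu uv

      -- Splitting the cyclic structure along a triangle

      module Triangle (t : Fin 3 → Fin n) (St : ∀ i → S (t i)) (κt : ∀ i → κ (t i) ≡ i)
                      (edge : ∀ i → t i ~ t (nxt i)) where

        fore back own : Fin n → Fin n
        fore v = t (nxt (κ v))
        back v = t (nxt (nxt (κ v)))
        own v  = t (κ v)

        T : Fin n → Set
        T v = v ≡ own v

        edge′ : ∀ i → t i ~ t (nxt (nxt i))
        edge′ i = flip (subst (λ j → t (nxt (nxt i)) ~ t j) (nxt-cycle i) (edge (nxt (nxt i))))

        own≁ : ∀ {v} → S v → v ≁ own v
        own≁ {v} Sv = part-independent Sv (St _) (sym (κt (κ v)))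

        -- Otherwise v and `own v` are common neighbours of the opposite triangle edge, hence
        -- adjacent by diamond-freeness, although they lie in one part.
        not-both-ends : ∀ {v} → S v → ¬ T v → v ~ fore v → v ~ back v → ⊥
        not-both-ends {v} Sv ¬Tv f b =
          clash (no-diamond (edge (nxt (κ v))) (flip f) (flip b)
                  (flip (edge (κ v))) (flip (edge′ (κ v))) ¬Tv) (own≁ Sv)

        -- All arcs between `Before` and the rest of S leave `Before`, and all arcs between `After`
        -- and the rest enter `After`; `Apart` misses the triangle. So only these three sets, all
        -- avoiding the triangle, are left to the induction.
        Before After Apart : Fin n → Set
        Before v = S v × ¬ T v × v ~ fore v
        After v  = S v × ¬ T v × v ≁ fore v × v ~ back v
        Apart v  = S v × ¬ T v × v ≁ fore v × v ≁ back v

        before≁back : ∀ {v} → Before v → v ≁ back v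
        before≁back (Sv , ¬Tv , f) = ¬~⇒≁ (not-both-ends Sv ¬Tv f)

        same : ∀ {u v} → S u → S v → κ v ≡ κ u → e u v ≡ ahead (κ u) (κ v)
        same Su Sv eq = trans (part-independent Su Sv (sym eq)) (sym (ahead-same eq))

        fore-of : ∀ {u v} → κ v ≡ nxt (κ u) → own v ≡ fore u
        fore-of eq = cong t eq

        back-of : ∀ {u v} → κ v ≡ nxt (κ u) → back v ≡ own u
        back-of {u} eq = cong t (trans (cong (nxt ∘ nxt) eq) (nxt-cycle (κ u)))

        fore-back : ∀ {u v} → κ v ≡ nxt (κ u) → fore v ≡ back u
        fore-back eq = cong t (cong nxt eq)

        at : ∀ {u x y b} → x ≡ y → e u x ≡ b → e u y ≡ b
        at refl = id

        before-T : ∀ {u v} → Before u → S v → T v → e u v ≡ ahead (κ u) (κ v)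
        before-T {u} {v} B@(Su , _ , f) Sv Tv with trichotomy (κ u) (κ v)
        ... | inj₁ eq = same Su Sv eq
        ... | inj₂ (inj₁ eq) =
          trans (at (sym (trans Tv (fore-of {u} {v} eq))) f) (sym (ahead-next eq))
        ... | inj₂ (inj₂ eq) =
          trans (at (sym (trans Tv (sym (back-of {v} {u} eq)))) (before≁back B)) (sym (ahead-prev eq))

        T-after : ∀ {u v} → S u → T u → After v → e u v ≡ ahead (κ u) (κ v)
        T-after {u} {v} Su Tu (Sv , _ , ¬f , b) with trichotomy (κ u) (κ v)
        ... | inj₁ eq = same Su Sv eq
        ... | inj₂ (inj₁ eq) =
          trans (flip (at (sym (trans Tu (sym (back-of {u} {v} eq)))) b)) (sym (ahead-next eq))
        ... | inj₂ (inj₂ eq) =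
          trans (flip (at (sym (trans Tu (fore-of {v} {u} eq))) ¬f)) (sym (ahead-prev eq))

        -- A non-edge to the next part would complete an independent triple with `back u`; an edge
        -- to the previous part would form an induced 2P₂ with the triangle edge from `own u` to
        -- `back u`.
        before-rest : ∀ {u v} → Before u → S v → v ≁ fore v → e u v ≡ ahead (κ u) (κ v)
        before-rest {u} {v} B@(Su , _ , f) Sv ¬f with trichotomy (κ u) (κ v)
        ... | inj₁ eq = same Su Sv eq
        ... | inj₂ (inj₁ eq) = trans (¬≁⇒~ λ u≁v →
                no-independent′ {u} {v} {back u} eq (trans (κt _) (cong nxt (sym eq))) Su Sv (St _)
                  u≁v (at (fore-back {u} {v} eq) ¬f) (flip (before≁back B)))
              (sym (ahead-next eq))
        ... | inj₂ (inj₂ eq) = trans (¬~⇒≁ λ u~v →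
                chains {own u} {u} {back u} {v} (St _) Su (St _) Sv (κt _) κ-back
                  (edge′ _) u~v (flip ¬f′) (before≁back B))
              (sym (ahead-prev eq))
          where
          ¬f′ : v ≁ own u
          ¬f′ = at (sym (fore-of {v} {u} eq)) ¬f
          κ-back : κ (back u) ≡ κ v
          κ-back = trans (κt _) (trans (cong (nxt ∘ nxt) eq) (nxt-cycle (κ v)))

        apart-after : ∀ {u v} → Apart u → After v → e u v ≡ ahead (κ u) (κ v)
        apart-after {u} {v} (Su , _ , ¬f′ , ¬b′) (Sv , _ , ¬f , b) with trichotomy (κ u) (κ v)
        ... | inj₁ eq = same Su Sv eq
        ... | inj₂ (inj₁ eq) = trans (¬≁⇒~ λ u≁v →
                no-independent′ {u} {v} {back u} eq (trans (κt _) (cong nxt (sym eq))) Su Sv (St _)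
                  u≁v (at (fore-back {u} {v} eq) ¬f) (flip ¬b′))
              (sym (ahead-next eq))
        ... | inj₂ (inj₂ eq) = trans (¬~⇒≁ λ u~v →
                chains {own u} {u} {own v} {v} (St _) Su (St _) Sv (κt _) (κt _)
                  (flip (at (sym (fore-of {v} {u} eq)) (edge _))) u~v
                  (flip (at (sym (fore-of {v} {u} eq)) ¬f))
                  (at (back-of {v} {u} eq) ¬b′))
              (sym (ahead-prev eq))

        T-apart : ∀ {u v} → T u → Apart v → u ≁ v
        T-apart {u} {v} Tu (Sv , _ , ¬f , ¬b) with trichotomy (κ v) (κ u)
        ... | inj₁ eq = flip (at (sym (trans Tu (cong t eq))) (own≁ Sv))
        ... | inj₂ (inj₁ eq) = flip (at (sym (trans Tu (fore-of {v} {u} eq))) ¬f)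
        ... | inj₂ (inj₂ eq) = flip (at (sym (trans Tu (sym (back-of {u} {v} eq)))) ¬b)

        T-clique : ∀ {u v} → T u → T v → u ≢ v → u ~ v
        T-clique {u} {v} Tu Tv u≢v with trichotomy (κ u) (κ v)
        ... | inj₁ eq = ⊥-elim (u≢v (trans Tu (trans (cong t (sym eq)) (sym Tv))))
        ... | inj₂ (inj₁ eq) = subst₂ _~_ (sym Tu) (sym (trans Tv (fore-of {u} {v} eq))) (edge (κ u))
        ... | inj₂ (inj₂ eq) = flip (subst₂ _~_ (sym Tv) (sym (trans Tu (fore-of {v} {u} eq))) (edge (κ v)))

        assemble : (∀ v → Dec (S v)) → Built e κ Before → Built e κ After → Built e κ Apart →
                   Built e κ S
        assemble S? before after apart =
          cut before? ahead first (built-resp proj₂ (λ B → proj₁ B , B) before)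
            (cut after? (λ i j → ahead j i) last (built-resp proj₂ after′ after)
              (cut T? (λ _ _ → false) (λ (((Su , _) , _)) Tu A ¬Tv → T-apart Tu (apart′ A ¬Tv))
                (homogeneous dec (λ _ _ → true) (λ (_ , Tu) (_ , Tv) → T-clique Tu Tv))
                (built-resp (λ (A , ¬Tv) → apart′ A ¬Tv) apart″ apart)))
          where
          T? : ∀ v → Dec (T v)
          T? v = v ≟ own v
          before? : ∀ v → Dec (Before v)
          before? v = S? v ×-dec ¬? (T? v) ×-dec (v ~? fore v)
          after? : ∀ v → Dec (After v)
          after? v = S? v ×-dec ¬? (T? v) ×-dec (v ≁? fore v) ×-dec (v ~? back v)
          dec : ∀ v → Dec (((S v × ¬ Before v) × ¬ After v) × T v)
          dec v = ((S? v ×-dec ¬? (before? v)) ×-dec ¬? (after? v)) ×-dec T? v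
          apart′ : ∀ {v} → (S v × ¬ Before v) × ¬ After v → ¬ T v → Apart v
          apart′ ((Sv , ¬B) , ¬A) ¬Tv = Sv , ¬Tv , ¬f , ¬~⇒≁ (λ b → ¬A (Sv , ¬Tv , ¬f , b))
            where ¬f = ¬~⇒≁ (λ f → ¬B (Sv , ¬Tv , f))
          apart″ : ∀ {v} → Apart v → ((S v × ¬ Before v) × ¬ After v) × ¬ T v
          apart″ (Sv , ¬Tv , ¬f , ¬b) =
            ((Sv , λ (_ , _ , f) → clash f ¬f) , λ (_ , _ , _ , b) → clash b ¬b) , ¬Tv
          after′ : ∀ {v} → After v → (S v × ¬ Before v) × After v
          after′ A@(Sv , _ , ¬f , _) = (Sv , λ (_ , _ , f) → clash f ¬f) , A
          first : ∀ {u v} → S u → Before u → S v → ¬ Before v → e u v ≡ ahead (κ u) (κ v)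
          first {u} {v} _ B Sv ¬Bv with T? v
          ... | yes Tv = before-T B Sv Tv
          ... | no ¬Tv = before-rest B Sv (¬~⇒≁ λ f → ¬Bv (Sv , ¬Tv , f))
          last : ∀ {u v} → S u × ¬ Before u → After u → S v × ¬ Before v → ¬ After v →
                 e u v ≡ ahead (κ v) (κ u)
          last {u} {v} _ A (Sv , ¬B) ¬A with T? v
          ... | yes Tv = flip (T-after Sv Tv A)
          ... | no ¬Tv = flip (apart-after (apart′ ((Sv , ¬B) , ¬A) ¬Tv) A)

    cyclic-mono : ∀ {S P} → (∀ {v} → P v → S v) → Cyclic S → Cyclic P
    cyclic-mono P⊆S C = record
      { part-independent = λ a b → part-independent (P⊆S a) (P⊆S b)
      ; chains = λ a a′ b b′ → chains (P⊆S a) (P⊆S a′) (P⊆S b) (P⊆S b′)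
      ; no-independent = λ p q r a b c → no-independent p q r (P⊆S a) (P⊆S b) (P⊆S c)
      }
      where open Cyclic C

    cyclic-built : ∀ S → (∀ v → Dec (S v)) → Cyclic S → Built e κ S
    cyclic-built = subset-induction (λ S → (∀ v → Dec (S v)) → Cyclic S → Built e κ S) step
      where
      step : ∀ S → (∀ P → (∀ {v} → P v → S v) → (∃ λ v → S v × ¬ P v) →
                    (∀ v → Dec (P v)) → Cyclic P → Built e κ P) →
             (∀ v → Dec (S v)) → Cyclic S → Built e κ S
      step S ih S? C with any? (λ u → any? (λ v → any? (λ w →
        (κ u ≟ zero ×-dec κ v ≟ suc zero ×-dec κ w ≟ suc (suc zero)) ×-dec
        (S? u ×-dec S? v ×-dec S? w) ×-dec (u ~? v ×-dec v ~? w ×-dec w ~? u))))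
      ... | yes (u , v , w , (κu , κv , κw) , (Su , Sv , Sw) , (uv , vw , wu)) =
        assemble S?
          (smaller Before proj₁ (λ (_ , ¬T , _) → ¬T) λ x →
            S? x ×-dec ¬? (x ≟ own x) ×-dec (x ~? fore x))
          (smaller After proj₁ (λ (_ , ¬T , _) → ¬T) λ x →
            S? x ×-dec ¬? (x ≟ own x) ×-dec (x ≁? fore x) ×-dec (x ~? back x))
          (smaller Apart proj₁ (λ (_ , ¬T , _) → ¬T) λ x →
            S? x ×-dec ¬? (x ≟ own x) ×-dec (x ≁? fore x) ×-dec (x ≁? back x))
        where
        t : Fin 3 → Fin n
        t zero             = u
        t (suc zero)       = v
        t (suc (suc zero)) = w
        St : ∀ i → S (t i)
        St zero             = Su
        St (suc zero)       = Sv
        St (suc (suc zero)) = Sw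
        κt : ∀ i → κ (t i) ≡ i
        κt zero             = κu
        κt (suc zero)       = κv
        κt (suc (suc zero)) = κw
        edge : ∀ i → t i ~ t (nxt i)
        edge zero             = uv
        edge (suc zero)       = vw
        edge (suc (suc zero)) = wu
        open Triangle C t St κt edge
        smaller : ∀ P → (∀ {x} → P x → S x) → (∀ {x} → P x → ¬ T x) → (∀ x → Dec (P x)) → Built e κ P
        smaller P P⊆S avoid P? =
          ih P P⊆S (u , Su , λ Pu → avoid Pu (cong t (sym κu))) P? (cyclic-mono P⊆S C)
      ... | no none = search (filter S? (allFin n)) refl
        where
        no-triangle : ∀ {u v w} → κ v ≡ nxt (κ u) → κ w ≡ nxt (κ v) →
                      S u → S v → S w → u ~ v → v ~ w → w ~ u → ⊥
        no-triangle = rotate (λ u v w → S u → S v → S w → u ~ v → v ~ w → w ~ u → ⊥)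
          (λ f a b c x y z → f c a b z x y)
          (λ p q r a b c x y z → none (_ , _ , _ , (p , q , r) , (a , b , c) , (x , y , z)))
        search : ∀ xs → filter S? (allFin n) ≡ xs → Built e κ S
        search [] eq = empty λ {v} Sv → ∉[] (subst (v ∈_) eq (∈-filter⁺ S? (∈-allFin v) Sv))
          where
          ∉[] : ∀ {v : Fin n} → v ∈ [] → ⊥
          ∉[] ()
        -- Without triangles a source s exists, and `ahead` describes all its adjacencies, so s can
        -- be united with everything else.
        search (x ∷ xs) eq =
          let s , s∈ , minimal = source C no-triangle x xs ⊆S
              peel : ∀ {v} → S v → e s v ≡ ahead (κ s) (κ v)
              peel {v} Sv = [ (λ eq → trans (Cyclic.part-independent C (⊆S s∈) Sv eq)
                                            (sym (ahead-same (sym eq)))) ,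
                              [ arc-ahead , (λ vs → ⊥-elim (minimal (S⊆ Sv) vs)) ]′ ]′
                            (arc-or-same s v)
          in cut (_≟ s) ahead (λ { _ refl Sv _ → peel Sv })
               (point s (⊆S s∈ , refl) proj₂)
               (ih _ proj₁ (s , ⊆S s∈ , λ (_ , s≢s) → s≢s refl) (λ v → S? v ×-dec ¬? (v ≟ s))
                   (cyclic-mono proj₁ C))
          where
          ⊆S : ∀ {y} → y ∈ x ∷ xs → S y
          ⊆S {y} y∈ = proj₂ (∈-filter⁻ S? {xs = allFin n} (subst (y ∈_) (sym eq) y∈))
          S⊆ : ∀ {v} → S v → v ∈ x ∷ xs
          S⊆ {v} Sv = subst (v ∈_) eq (∈-filter⁺ S? (∈-allFin v) Sv)

-- Bipartite and complete multipartite graphs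

two-colours : ∀ {x y z : Bool} → x ≢ y → z ≢ y → x ≡ z
two-colours x≢y z≢y = trans (¬-not x≢y) (sym (¬-not z≢y))

xor-≡ : ∀ {x y} → x ≡ y → x xor y ≡ false
xor-≡ {x} refl = xor-same x

xor-≢ : ∀ {x y} → x ≢ y → x xor y ≡ true
xor-≢ {false} x≢y = ¬-not (x≢y ∘ sym)
xor-≢ {true}  x≢y = sym (¬-not x≢y)

module _ {n : ℕ} (𝒢 : Free n) where
  open Free 𝒢

  module _ (col : Fin n → Bool) where

    Bipartite : (Fin n → Set) → Set
    Bipartite S = ∀ {u v} → S u → S v → col u ≡ col v → u ≁ v

    private
      -- A chain graph is treated as a cyclic structure whose third part is void, where
      -- `no-independent` holds vacuously.
      part : Bool → Fin 3
      part c = if c then zero else suc zero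

      part-injective : ∀ {c d} → part c ≡ part d → c ≡ d
      part-injective {true}  {true}  _ = refl
      part-injective {false} {false} _ = refl

      two-parts : ∀ {c} → part c ≢ suc (suc zero)
      two-parts {true} ()
      two-parts {false} ()

    module _ {S : Fin n → Set} (bip : Bipartite S) where

      opposite : ∀ {u v} → S u → S v → u ~ v → col u ≢ col v
      opposite Su Sv u~v eq = clash u~v (bip Su Sv eq)

      -- An induced 2P₂ with edges ab′ and a′b. In the bipartite complement ab is an edge, and a′
      -- will turn out to lie in another component.
      module Split {a b a′ b′} (Sa : S a) (Sb : S b) (Sa′ : S a′) (Sb′ : S b′)
                   (aa′ : col a ≡ col a′) (bb′ : col b ≡ col b′)
                   (ab′ : a ~ b′) (a′b : a′ ~ b) (¬ab : a ≁ b) (¬a′b′ : a′ ≁ b′) where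

        anchor : Fin n → Fin n
        anchor v = if does (col v ≟ᵇ col a) then a else b

        a≢b : col a ≢ col b
        a≢b eq = opposite Sa′ Sb a′b (trans (sym aa′) eq)

        anchor-cases : ∀ v → (anchor v ≡ a × col v ≡ col a) ⊎ (anchor v ≡ b × col v ≡ col b)
        anchor-cases v with col v ≟ᵇ col a
        ... | yes eq = inj₁ (refl , eq)
        ... | no neq = inj₂ (refl , two-colours neq (a≢b ∘ sym))

        S-anchor : ∀ v → S (anchor v)
        S-anchor v with anchor-cases v
        ... | inj₁ (eq , _) = subst S (sym eq) Sa
        ... | inj₂ (eq , _) = subst S (sym eq) Sb

        col-anchor : ∀ v → col (anchor v) ≡ col v
        col-anchor v with anchor-cases v
        ... | inj₁ (eq , c) = trans (cong col eq) (sym c)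
        ... | inj₂ (eq , c) = trans (cong col eq) (sym c)

        anchors≁ : ∀ u v → col u ≢ col v → anchor u ≁ anchor v
        anchors≁ u v u≢v with anchor-cases u | anchor-cases v
        ... | inj₁ (_ , p)  | inj₁ (_ , q)  = ⊥-elim (u≢v (trans p (sym q)))
        ... | inj₂ (_ , p)  | inj₂ (_ , q)  = ⊥-elim (u≢v (trans p (sym q)))
        ... | inj₁ (eq , _) | inj₂ (eq′ , _) = subst₂ _≁_ (sym eq) (sym eq′) ¬ab
        ... | inj₂ (eq , _) | inj₁ (eq′ , _) = subst₂ _≁_ (sym eq) (sym eq′) (flip ¬ab)

        -- In the bipartite complement the neighbourhoods are laminar on each side;
        -- this is the component of a and b there.
        Component : Fin n → Set
        Component v = ∃ λ w → S w × col w ≢ col v × w ≁ v × w ≁ anchor v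

        -- A non-edge uv between the colours would put v into the component, witnessed by α or by u,
        -- unless αv and uβ are edges; these form a 2P₂ missed by the witness w of u.
        across : ∀ {u v} → S u → Component u → S v → ¬ Component v → e u v ≡ col u xor col v
        across {u} {v} Su (w , Sw , w≢u , wu , wα) Sv ¬Cv with col u ≟ᵇ col v
        ... | yes eq = trans (bip Su Sv eq) (sym (xor-≡ eq))
        ... | no neq = trans (¬≁⇒~ absurd) (sym (xor-≢ neq))
          where
          α = anchor u
          β = anchor v
          α≢v : col α ≢ col v
          α≢v eq = neq (trans (sym (col-anchor u)) eq)
          w≡v : col w ≡ col v
          w≡v = two-colours w≢u (neq ∘ sym)
          absurd : u ≁ v → ⊥
          absurd u≁v with edge? α v | edge? u β
          ... | inj₂ α≁v | _        = ¬Cv (α , S-anchor u , α≢v , α≁v , anchors≁ u v neq)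
          ... | inj₁ _   | inj₂ u≁β = ¬Cv (u , Su , neq , u≁v , u≁β)
          ... | inj₁ α~v | inj₁ u~β =
            no-P₁+2P₂ α~v u~β (bip (S-anchor u) Su (col-anchor u)) (anchors≁ u v neq) (flip u≁v)
              (bip Sv (S-anchor v) (sym (col-anchor v))) wα (bip Sw Sv w≡v) wu
              (bip Sw (S-anchor v) (trans w≡v (sym (col-anchor v))))

        anchor-of : ∀ {v} → col v ≡ col a → anchor v ≡ a
        anchor-of {v} eq = [ proj₁ , (λ (_ , c) → ⊥-elim (a≢b (trans (sym eq) c))) ]′ (anchor-cases v)

        component-a : Component a
        component-a = b , Sb , (a≢b ∘ sym) , flip ¬ab ,
                      subst (b ≁_) (sym (anchor-of refl)) (flip ¬ab)

        -- A witness w would be an isolated vertex next to the 2P₂ with edges ab′ and a′b.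
        not-component-a′ : ¬ Component a′
        not-component-a′ (w , Sw , w≢a′ , wa′ , wα) =
          no-P₁+2P₂ ab′ a′b (bip Sa Sa′ aa′) ¬ab (flip ¬a′b′) (bip Sb′ Sb (sym bb′))
            (subst (w ≁_) (anchor-of (sym aa′)) wα) (bip Sw Sb′ w≡b′) wa′
            (bip Sw Sb (trans w≡b′ (sym bb′)))
          where w≡b′ = two-colours w≢a′ (opposite Sb′ Sa (flip ab′) ∘ (λ eq → trans eq (sym aa′)))

    bipartite-built : ∀ S → (∀ v → Dec (S v)) → Bipartite S → Built e col S
    bipartite-built = subset-induction (λ S → (∀ v → Dec (S v)) → Bipartite S → Built e col S) step
      where
      step : ∀ S → (∀ P → (∀ {v} → P v → S v) → (∃ λ v → S v × ¬ P v) →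
                    (∀ v → Dec (P v)) → Bipartite P → Built e col P) →
             (∀ v → Dec (S v)) → Bipartite S → Built e col S
      step S ih S? bip with any? (λ a → any? (λ a′ → any? (λ b → any? (λ b′ →
        (S? a ×-dec S? a′ ×-dec S? b ×-dec S? b′) ×-dec
        (col a ≟ᵇ col a′) ×-dec (col b ≟ᵇ col b′) ×-dec
        (a ~? b′) ×-dec (a′ ~? b) ×-dec (a ≁? b) ×-dec (a′ ≁? b′)))))
      ... | yes (a , a′ , b , b′ , (Sa , Sa′ , Sb , Sb′) , aa′ , bb′ , ab′ , a′b , ¬ab , ¬a′b′) =
        cut comp? _xor_ across
          (ih _ proj₁ (a′ , Sa′ , not-component-a′ ∘ proj₂) (λ v → S? v ×-dec comp? v)
              (λ p q → bip (proj₁ p) (proj₁ q)))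
          (ih _ proj₁ (a , Sa , λ (_ , ¬Ca) → ¬Ca component-a) (λ v → S? v ×-dec ¬? (comp? v))
              (λ p q → bip (proj₁ p) (proj₁ q)))
        where
        open Split bip Sa Sb Sa′ Sb′ aa′ bb′ ab′ a′b ¬ab ¬a′b′
        comp? : ∀ v → Dec (Component v)
        comp? v = any? (λ w → S? w ×-dec ¬? (col w ≟ᵇ col v) ×-dec (w ≁? v) ×-dec (w ≁? anchor v))
      ... | no none = refine part (λ _ → refl) (cyclic-built 𝒢 (part ∘ col) S S? record
        { part-independent = λ Su Sv eq → bip Su Sv (part-injective eq)
        -- The search asks for edges ab′ and a′b, so the two vertices of the second part change
        -- places.
        ; chains = λ Sa Sa′ Sb Sb′ aa′ bb′ ab a′b′ ab′ a′b → none
            (_ , _ , _ , _ , (Sa , Sa′ , Sb′ , Sb) , part-injective aa′ , part-injective (sym bb′) ,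
             ab , a′b′ , ab′ , a′b)
        ; no-independent = λ _ _ q → ⊥-elim (two-parts q)
        })

  -- A diamond-free complete multipartite graph is edgeless, complete or complete
  -- bipartite.
  complete-multipartite : ∀ (U : Fin n → Set) → (∀ v → Dec (U v)) →
    (∀ {u v w} → U u → U v → U w → u ~ v → w ≁ u → w ≁ v → ⊥) → Fin n →
    ∃ λ r → ∃ λ f → ∀ {u v} → U u → U v → u ≢ v → e u v ≡ f (e r u) (e r v)
  complete-multipartite U U? hit d
    with any? (λ r → any? (λ s → U? r ×-dec U? s ×-dec r ~? s))
  -- Without edges any vertex may serve as the reference; d supplies one even when U is empty.
  ... | no none = d , (λ _ _ → false) , λ Uu Uv _ → ¬~⇒≁ λ uv → none (_ , _ , Uu , Uv , uv)
  ... | yes (r , s , Ur , Us , rs) with any? (λ t → U? t ×-dec r ~? t ×-dec s ~? t)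
  ...   | no none = r , _xor_ , bipartite
    where
    third : ∀ {t} → U t → r ~ t → s ≁ t
    third Ut rt = ¬~⇒≁ λ st → none (_ , Ut , rt , st)
    bipartite : ∀ {u v} → U u → U v → u ≢ v → e u v ≡ e r u xor e r v
    bipartite {u} {v} Uu Uv _ with e r u in ru | e r v in rv
    ... | true  | true  = ¬~⇒≁ λ uv → hit Uu Uv Us uv (third Uu ru) (third Uv rv)
    ... | false | false = ¬~⇒≁ λ uv → hit Uu Uv Ur uv ru rv
    ... | true  | false = ¬≁⇒~ λ uv → hit Uu Ur Uv (flip ru) (flip uv) (flip rv)
    ... | false | true  = ¬≁⇒~ λ uv → hit Ur Uv Uu rv (flip ru) uv
  ...   | yes (t , Ut , rt , st) = r , (λ _ _ → true) , clique
    where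
    -- A vertex u missing r lies in the part of r, hence is adjacent to s and t and completes a
    -- diamond.
    universal : ∀ {r s t} → U r → U s → U t → r ~ s → s ~ t → r ~ t → ∀ {u} → U u → u ≢ r → u ~ r
    universal Ur Us Ut rs st rt {u} Uu u≢r = ¬≁⇒~ λ ur →
      clash (no-diamond st (flip rs) (flip rt)
        (¬≁⇒~ λ su → hit Ur Us Uu rs ur (flip su)) (¬≁⇒~ λ tu → hit Ur Ut Uu rt ur (flip tu)) (u≢r ∘ sym))
        (flip ur)
    clique : ∀ {u v} → U u → U v → u ≢ v → u ~ v
    clique {u} {v} Uu Uv u≢v with u ≟ r | v ≟ r | u ≟ s | v ≟ s
    ... | yes refl | _ | _ | _ = flip (universal Ur Us Ut rs st rt Uv (u≢v ∘ sym))
    ... | _ | yes refl | _ | _ = universal Ur Us Ut rs st rt Uu u≢v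
    ... | _ | _ | yes refl | _ = flip (universal Us Ur Ut (flip rs) rt st Uv (u≢v ∘ sym))
    ... | _ | _ | _ | yes refl = universal Us Ur Ut (flip rs) rt st Uu u≢v
    ... | no u≢r | no v≢r | no u≢s | no v≢s =
      no-diamond rs
        (flip (universal Ur Us Ut rs st rt Uu u≢r)) (flip (universal Us Ur Ut (flip rs) rt st Uu u≢s))
        (flip (universal Ur Us Ut rs st rt Uv v≢r)) (flip (universal Us Ur Ut (flip rs) rt st Uv v≢s)) u≢v

-- Graphs with a clique of at least five vertices

∨-true : ∀ {x y} → x ∨ y ≡ true → x ≡ true ⊎ y ≡ true
∨-true {true}  _  = inj₁ refl
∨-true {false} eq = inj₂ eq

if-cong : ∀ {b x c d : Bool} → (b ≡ true → x ≡ c) → (b ≡ false → x ≡ d) → x ≡ (if b then c else d)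
if-cong {true}  t f = t refl
if-cong {false} t f = f refl

module _ {n : ℕ} (𝒢 : Free n) where
  open Free 𝒢

  Typed : ℕ → Set₁
  Typed m = ∃ λ (τ : Fin n → Vec Bool m) → Built e τ (λ _ → ⊤)

  -- The deleted vertices return one at a time, each for one more entry in the types; repetitions in
  -- ds do no harm.
  add-all : ∀ {m k} {rs : Vec (Fin n) m} (ds : Vec (Fin n) k) →
            Built e (bits e rs) (λ v → All (v ≢_) ds) → Typed (k + m)
  add-all [] b = _ , built-resp (λ _ → []) (λ _ → tt) b
  add-all {m} {suc k} (d ∷ ds) b = subst Typed (+-suc k m)
    (add-all ds (add d (λ v → allᵥ? (λ c → ¬? (v ≟ c)) ds)
      (built-resp (λ (v≢ds , v≢d) → v≢d ∷ v≢ds) (λ { (v≢d ∷ v≢ds) → v≢ds , v≢d }) b)))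

  module LargeClique {x y z₁ z₂ z₃} (xy : x ~ y) (xz₁ : x ~ z₁) (xz₂ : x ~ z₂) (xz₃ : x ~ z₃)
    (yz₁ : y ~ z₁) (yz₂ : y ~ z₂) (yz₃ : y ~ z₃) (z₁₂ : z₁ ~ z₂) (z₁₃ : z₁ ~ z₃) (z₂₃ : z₂ ~ z₃) where

    -- The unique maximal clique through the edge xy, since diamond-freeness makes the common
    -- neighbours of x and y pairwise adjacent.
    K : Fin n → Set
    K v = v ≡ x ⊎ v ≡ y ⊎ (x ~ v × y ~ v)

    K? : ∀ v → Dec (K v)
    K? v = v ≟ x ⊎-dec v ≟ y ⊎-dec (x ~? v ×-dec y ~? v)

    K-clique : ∀ {u v} → K u → K v → u ≢ v → u ~ v
    K-clique (inj₁ refl)             (inj₁ refl)             ne = ⊥-elim (ne refl)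
    K-clique (inj₁ refl)             (inj₂ (inj₁ refl))      ne = xy
    K-clique (inj₁ refl)             (inj₂ (inj₂ (xv , _)))  ne = xv
    K-clique (inj₂ (inj₁ refl))      (inj₁ refl)             ne = flip xy
    K-clique (inj₂ (inj₁ refl))      (inj₂ (inj₁ refl))      ne = ⊥-elim (ne refl)
    K-clique (inj₂ (inj₁ refl))      (inj₂ (inj₂ (_ , yv)))  ne = yv
    K-clique (inj₂ (inj₂ (xu , _)))  (inj₁ refl)             ne = flip xu
    K-clique (inj₂ (inj₂ (_ , yu)))  (inj₂ (inj₁ refl))      ne = flip yu
    K-clique (inj₂ (inj₂ (xu , yu))) (inj₂ (inj₂ (xv , yv))) ne = no-diamond xy xu yu xv yv ne

    one-neighbour : ∀ {u k k′} → ¬ K u → K k → K k′ → k ≢ k′ → u ~ k → u ~ k′ → ⊥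
    one-neighbour {u} {k} {k′} ¬Ku Kk Kk′ k≢k′ uk uk′ =
      ¬Ku (inj₂ (inj₂ (flip (every (inj₁ refl)) , flip (every (inj₂ (inj₁ refl))))))
      where
      every : ∀ {c} → K c → u ~ c
      every {c} Kc with c ≟ k | c ≟ k′
      ... | yes refl | _        = uk
      ... | no _     | yes refl = uk′
      ... | no c≢k   | no c≢k′  =
        no-diamond (K-clique Kk Kk′ k≢k′) (flip uk) (flip uk′)
          (K-clique Kk Kc (c≢k ∘ sym)) (K-clique Kk′ Kc (c≢k′ ∘ sym)) (λ { refl → ¬Ku Kc })

    -- Moves the distinctness from q into the predicate carried by `avoid`, so that it survives the
    -- passage to a subfamily.
    together : ∀ {m} {qs : Vec (Fin n) m} {P : Fin n → Set} {q} → All (q ≢_) qs →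
               All (λ r → K r × P r) qs → All (λ r → K r × (P r × q ≢ r)) qs
    together []         []                = []
    together (q≢ ∷ q≢s) ((Kr , Pr) ∷ Krs) = (Kr , Pr , q≢) ∷ together q≢s Krs

    -- Each vertex outside K is adjacent to at most one of the given vertices of K.
    avoid : ∀ {m} {P : Fin n → Set} {u} → ¬ K u → (qs : Vec (Fin n) (suc m)) → AllPairs _≢_ qs →
            All (λ q → K q × P q) qs →
            ∃ λ (rs : Vec (Fin n) m) → AllPairs _≢_ rs × All (λ q → K q × P q × u ≁ q) rs
    avoid {ℕ.zero} ¬Ku (q ∷ []) _ _ = [] , [] , []
    avoid {suc m} {u = u} ¬Ku (q ∷ qs) (q≢ ∷ ps) ((Kq , Pq) ∷ Kqs) with edge? u q
    ... | inj₁ u~q = qs , ps , others q≢ Kqs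
      where
      others : ∀ {m} {qs : Vec (Fin n) m} {P : Fin n → Set} → All (q ≢_) qs → All (λ q → K q × P q) qs →
               All (λ q → K q × P q × u ≁ q) qs
      others []         []                = []
      others (q≢ ∷ q≢s) ((Kr , Pr) ∷ Krs) =
        (Kr , Pr , ¬~⇒≁ (one-neighbour ¬Ku Kq Kr q≢ u~q)) ∷ others q≢s Krs
    ... | inj₂ u≁q with rs , rs-distinct , Krs ← avoid ¬Ku qs ps (together q≢ Kqs) =
      q ∷ rs , mapₐ (λ (_ , (_ , q≢r) , _) → q≢r) Krs ∷ rs-distinct ,
      (Kq , Pq , u≁q) ∷ mapₐ (λ (Kr , (Pr , _) , ur) → Kr , Pr , ur) Krs

    K-vertices : Vec (Fin n) 5
    K-vertices = x ∷ y ∷ z₁ ∷ z₂ ∷ z₃ ∷ []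

    -- Each of u, v, w rules out at most one of five clique vertices; two that remain give the
    -- second edge of a P₁ + 2P₂.
    hit : ∀ {u v w} → ¬ K u → ¬ K v → ¬ K w → u ~ v → w ≁ u → w ≁ v → ⊥
    hit ¬Ku ¬Kv ¬Kw uv wu wv
      with avoid {P = λ _ → ⊤} ¬Ku K-vertices
             ( (~⇒≢ xy ∷ ~⇒≢ xz₁ ∷ ~⇒≢ xz₂ ∷ ~⇒≢ xz₃ ∷ [])
             ∷ (~⇒≢ yz₁ ∷ ~⇒≢ yz₂ ∷ ~⇒≢ yz₃ ∷ [])
             ∷ (~⇒≢ z₁₂ ∷ ~⇒≢ z₁₃ ∷ []) ∷ (~⇒≢ z₂₃ ∷ []) ∷ [] ∷ [])
             ( (inj₁ refl , tt) ∷ (inj₂ (inj₁ refl) , tt) ∷ (inj₂ (inj₂ (xz₁ , yz₁)) , tt)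
             ∷ (inj₂ (inj₂ (xz₂ , yz₂)) , tt) ∷ (inj₂ (inj₂ (xz₃ , yz₃)) , tt) ∷ [])
    ... | rs , ps , Krs with avoid ¬Kv rs ps Krs
    ... | rs′ , ps′ , Krs′ with avoid ¬Kw rs′ ps′ Krs′
    ... | q ∷ r ∷ [] , (q≢r ∷ []) ∷ _ , (Kq , ((_ , uq) , vq) , wq) ∷ (Kr , ((_ , ur) , vr) , wr) ∷ [] =
      no-P₁+2P₂ uv (K-clique Kq Kr q≢r) uq ur vq vr wu wv wq wr

    large-clique-built : Typed 2
    large-clique-built with complete-multipartite 𝒢 (¬_ ∘ K) (¬? ∘ K?) hit x
    ... | r , f , outside = τ , blocks β across cross block
      where
      τ : Fin n → Vec Bool 2
      τ v = does (K? v) ∷ e r v ∷ []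

      -- The centre of the block of v. An outside vertex without neighbours in K defaults to itself,
      -- which lies outside K and so never names the block of a clique vertex.
      β : Fin n → Fin n
      β v with K? v | any? (λ k → K? k ×-dec v ~? k)
      ... | yes _ | _           = v
      ... | no _  | yes (k , _) = k
      ... | no _  | no _        = v

      β-K : ∀ {v} → K v → β v ≡ v
      β-K {v} Kv with K? v | any? (λ k → K? k ×-dec v ~? k)
      ... | yes _  | _ = refl
      ... | no ¬Kv | _ = ⊥-elim (¬Kv Kv)

      β-outside : ∀ {v} → ¬ K v → K (β v) → v ~ β v
      β-outside {v} ¬Kv Kβ with K? v | any? (λ k → K? k ×-dec v ~? k)
      ... | yes Kv | _                 = ⊥-elim (¬Kv Kv)
      ... | no _   | yes (k , Kk , vk) = vk
      ... | no _   | no _              = ⊥-elim (¬Kv Kβ)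

      β-neighbour : ∀ {v k} → ¬ K v → K k → v ~ k → β v ≡ k
      β-neighbour {v} {k} ¬Kv Kk vk with K? v | any? (λ k → K? k ×-dec v ~? k)
      ... | yes Kv | _                = ⊥-elim (¬Kv Kv)
      ... | no _   | no none          = ⊥-elim (none (k , Kk , vk))
      ... | no _   | yes (c , Kc , vc) with c ≟ k
      ...   | yes eq = eq
      ...   | no ne  = ⊥-elim (one-neighbour ¬Kv Kc Kk ne vc vk)

      kind : ∀ v → (K v × does (K? v) ≡ true) ⊎ (¬ K v × does (K? v) ≡ false)
      kind v with K? v
      ... | yes Kv = inj₁ (Kv , dec-true (K? v) Kv)
      ... | no ¬Kv = inj₂ (¬Kv , dec-false (K? v) ¬Kv)

      across within : Vec Bool 2 → Vec Bool 2 → Bool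
      across (s ∷ a ∷ []) (t ∷ b ∷ []) = if s then t else if t then false else f a b
      within (s ∷ a ∷ []) (t ∷ b ∷ []) = if s then true else if t then true else f a b

      cross : ∀ {u v} → ⊤ → ⊤ → β u ≢ β v → e u v ≡ across (τ u) (τ v)
      cross {u} {v} _ _ ne with kind u | kind v
      ... | inj₁ (Ku , p) | inj₁ (Kv , q) rewrite p | q = K-clique Ku Kv (ne ∘ cong β)
      ... | inj₁ (Ku , p) | inj₂ (¬Kv , q) rewrite p | q =
        ¬~⇒≁ λ uv → ne (trans (β-K Ku) (sym (β-neighbour ¬Kv Ku (flip uv))))
      ... | inj₂ (¬Ku , p) | inj₁ (Kv , q) rewrite p | q =
        ¬~⇒≁ λ uv → ne (trans (β-neighbour ¬Ku Kv uv) (sym (β-K Kv)))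
      ... | inj₂ (¬Ku , p) | inj₂ (¬Kv , q) rewrite p | q = outside ¬Ku ¬Kv (ne ∘ cong β)

      centre : ∀ {u v i} → β u ≡ i → β v ≡ i → K u → ¬ K v → v ~ u
      centre {u} {v} refl eq Ku ¬Kv =
        subst (v ~_) βv≡u (β-outside ¬Kv (subst K (sym βv≡u) Ku))
        where βv≡u = trans eq (β-K Ku)

      block : ∀ i → Built e τ (λ v → ⊤ × β v ≡ i)
      block i = homogeneous (λ v → yes tt ×-dec (β v ≟ i)) within inside
        where
        inside : ∀ {u v} → ⊤ × β u ≡ i → ⊤ × β v ≡ i → u ≢ v → e u v ≡ within (τ u) (τ v)
        inside {u} {v} (_ , p) (_ , q) ne with kind u | kind v
        ... | inj₁ (Ku , x)  | inj₁ (Kv , _)  rewrite x     = K-clique Ku Kv ne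
        ... | inj₁ (Ku , x)  | inj₂ (¬Kv , _) rewrite x     = flip (centre p q Ku ¬Kv)
        ... | inj₂ (¬Ku , x) | inj₁ (Kv , y)  rewrite x | y = centre q p Kv ¬Ku
        ... | inj₂ (¬Ku , x) | inj₂ (¬Kv , y) rewrite x | y = outside ¬Ku ¬Kv ne

  module MaximalClique {m} (q : Fin m → Fin n) (clique : ∀ {i j} → i ≢ j → q i ~ q j)
                       (maximal : ∀ {v} → ¬ (∀ i → v ~ q i)) (d : Fin n) where

    Outside : Fin n → Set
    Outside v = ∀ i → v ≢ q i

    one-neighbour : ∀ {v i j} → Outside v → i ≢ j → q i ~ v → q j ~ v → ⊥
    one-neighbour {v} {i} {j} out i≢j iv jv = maximal every
      where
      every : ∀ k → v ~ q k
      every k with k ≟ i | k ≟ j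
      ... | yes refl | _        = flip iv
      ... | no _     | yes refl = flip jv
      ... | no k≢i   | no k≢j   =
        no-diamond (clique i≢j) iv jv (clique (k≢i ∘ sym)) (clique (k≢j ∘ sym)) (out k)

    U : Fin m → Fin m → Fin n → Set
    U i j v = Outside v × q i ≁ v × q j ≁ v

    U? : ∀ i j v → Dec (U i j v)
    U? i j v = all? (λ k → ¬? (v ≟ q k)) ×-dec q i ≁? v ×-dec q j ≁? v

    U-hit : ∀ {i j} → i ≢ j → ∀ {u v w} → U i j u → U i j v → U i j w → u ~ v → w ≁ u → w ≁ v → ⊥
    U-hit i≢j (_ , iu , ju) (_ , iv , jv) (_ , iw , jw) uv wu wv =
      no-P₁+2P₂ uv (clique i≢j) (flip iu) (flip ju) (flip iv) (flip jv) wu wv (flip iw) (flip jw)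

    -- Two positions i and j unblocked for u and v put both vertices into `U i j`, where one
    -- multipartite rule decides.
    blocked : Fin n → Fin n → Fin m → Bool
    blocked u v k = e (q k) u ∨ e (q k) v

    module _ {i j : Fin m} (i≢j : i ≢ j) where
      private U-multipartite = complete-multipartite 𝒢 (U i j) (U? i j) (U-hit i≢j) d

      rep : Fin n
      rep = proj₁ U-multipartite

      rule : Bool → Bool → Bool
      rule = proj₁ (proj₂ U-multipartite)

      rule-correct : ∀ {u v} → Outside u → Outside v → u ≢ v →
                     (blocked u v i ∨ blocked u v j) ≡ false → e u v ≡ rule (e rep u) (e rep v)
      rule-correct {u} {v} ou ov u≢v eq
        with e (q i) u in iu | e (q i) v in iv | e (q j) u in ju | e (q j) v in jv
      ... | false | false | false | false =
        proj₂ (proj₂ U-multipartite) (ou , iu , ju) (ov , iv , jv) u≢v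

-- Graphs with a maximal clique of four vertices

three-of-four : ∀ {a b c d : Bool} → (a ∨ b) ≡ true → (a ∨ c) ≡ true → (a ∨ d) ≡ true →
                (b ∨ c) ≡ true → (b ∨ d) ≡ true → (c ∨ d) ≡ true →
                (a ≡ true × b ≡ true × c ≡ true) ⊎ (a ≡ true × b ≡ true × d ≡ true) ⊎
                (a ≡ true × c ≡ true × d ≡ true) ⊎ (b ≡ true × c ≡ true × d ≡ true)
three-of-four {false}                      b c d _ _ _ = inj₂ (inj₂ (inj₂ (b , c , d)))
three-of-four {true} {false}               _ _ _ c d _ = inj₂ (inj₂ (inj₁ (refl , c , d)))
three-of-four {true} {true} {true}         _ _ _ _ _ _ = inj₁ (refl , refl , refl)
three-of-four {true} {true} {false}        _ _ _ _ _ d = inj₂ (inj₁ (refl , refl , d))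

module _ {n : ℕ} (𝒢 : Free n) where
  open Free 𝒢

  module FourClique (q : Fin 4 → Fin n) (clique : ∀ {i j} → i ≢ j → q i ~ q j)
                    (maximal : ∀ {v} → ¬ (∀ i → v ~ q i)) where
    open MaximalClique 𝒢 q clique maximal (q 0F)

    three-blocked : ∀ {u v i j k} → Outside u → Outside v → i ≢ j → i ≢ k → j ≢ k →
                    blocked u v i ≡ true → blocked u v j ≡ true → blocked u v k ≡ true → ⊥
    three-blocked ou ov ij ik jk bi bj bk with ∨-true bi | ∨-true bj | ∨-true bk
    ... | inj₁ x | inj₁ y | _      = one-neighbour ou ij x y
    ... | inj₁ x | inj₂ _ | inj₁ z = one-neighbour ou ik x z
    ... | inj₁ _ | inj₂ y | inj₂ z = one-neighbour ov jk y z
    ... | inj₂ _ | inj₁ y | inj₁ z = one-neighbour ou jk y z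
    ... | inj₂ x | inj₁ _ | inj₂ z = one-neighbour ov ik x z
    ... | inj₂ x | inj₂ y | _      = one-neighbour ov ij x y

    ≢₀₁ : _≢_ {A = Fin 4} 0F 1F
    ≢₀₁ ()
    ≢₀₂ : _≢_ {A = Fin 4} 0F 2F
    ≢₀₂ ()
    ≢₀₃ : _≢_ {A = Fin 4} 0F 3F
    ≢₀₃ ()
    ≢₁₂ : _≢_ {A = Fin 4} 1F 2F
    ≢₁₂ ()
    ≢₁₃ : _≢_ {A = Fin 4} 1F 3F
    ≢₁₃ ()
    ≢₂₃ : _≢_ {A = Fin 4} 2F 3F
    ≢₂₃ ()

    refs : Vec (Fin n) 10
    refs = q 0F ∷ q 1F ∷ q 2F ∷ q 3F ∷ rep ≢₀₁ ∷ rep ≢₀₂ ∷ rep ≢₀₃ ∷ rep ≢₁₂ ∷ rep ≢₁₃ ∷ rep ≢₂₃ ∷ []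

    -- The first pair of clique vertices missed by both endpoints decides. Each endpoint blocks at
    -- most one of the four, so such a pair exists and the innermost `false` is never reached.
    M : Vec Bool 10 → Vec Bool 10 → Bool
    M (s₀ ∷ s₁ ∷ s₂ ∷ s₃ ∷ a ∷ b ∷ c ∷ d ∷ f ∷ g ∷ []) (t₀ ∷ t₁ ∷ t₂ ∷ t₃ ∷ a′ ∷ b′ ∷ c′ ∷ d′ ∷ f′ ∷ g′ ∷ []) =
      if (s₀ ∨ t₀) ∨ (s₁ ∨ t₁) then
      if (s₀ ∨ t₀) ∨ (s₂ ∨ t₂) then
      if (s₀ ∨ t₀) ∨ (s₃ ∨ t₃) then
      if (s₁ ∨ t₁) ∨ (s₂ ∨ t₂) then
      if (s₁ ∨ t₁) ∨ (s₃ ∨ t₃) then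
      if (s₂ ∨ t₂) ∨ (s₃ ∨ t₃) then false
      else rule ≢₂₃ g g′
      else rule ≢₁₃ f f′
      else rule ≢₁₂ d d′
      else rule ≢₀₃ c c′
      else rule ≢₀₂ b b′
      else rule ≢₀₁ a a′

    outside-M : ∀ {u v} → Outside u → Outside v → u ≢ v → e u v ≡ M (bits e refs u) (bits e refs v)
    outside-M {u} {v} ou ov u≢v =
      if-cong (λ x₀₁ → if-cong (λ x₀₂ → if-cong (λ x₀₃ → if-cong (λ x₁₂ → if-cong (λ x₁₃ → if-cong
        (λ x₂₃ → ⊥-elim (impossible x₀₁ x₀₂ x₀₃ x₁₂ x₁₃ x₂₃))
        (rule-correct ≢₂₃ ou ov u≢v)) (rule-correct ≢₁₃ ou ov u≢v)) (rule-correct ≢₁₂ ou ov u≢v))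
        (rule-correct ≢₀₃ ou ov u≢v)) (rule-correct ≢₀₂ ou ov u≢v)) (rule-correct ≢₀₁ ou ov u≢v)
      where
      b : Fin 4 → Bool
      b = blocked u v
      impossible : (b 0F ∨ b 1F) ≡ true → (b 0F ∨ b 2F) ≡ true → (b 0F ∨ b 3F) ≡ true →
                   (b 1F ∨ b 2F) ≡ true → (b 1F ∨ b 3F) ≡ true → (b 2F ∨ b 3F) ≡ true → ⊥
      impossible p₀₁ p₀₂ p₀₃ p₁₂ p₁₃ p₂₃ with three-of-four p₀₁ p₀₂ p₀₃ p₁₂ p₁₃ p₂₃
      ... | inj₁ (x , y , z)               = three-blocked ou ov ≢₀₁ ≢₀₂ ≢₁₂ x y z
      ... | inj₂ (inj₁ (x , y , z))        = three-blocked ou ov ≢₀₁ ≢₀₃ ≢₁₃ x y z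
      ... | inj₂ (inj₂ (inj₁ (x , y , z))) = three-blocked ou ov ≢₀₂ ≢₀₃ ≢₂₃ x y z
      ... | inj₂ (inj₂ (inj₂ (x , y , z))) = three-blocked ou ov ≢₁₂ ≢₁₃ ≢₂₃ x y z

    -- Four clique vertices and six representatives as references, and four entries for returning
    -- the clique.
    four-clique-built : Typed 𝒢 14
    four-clique-built = add-all 𝒢 (q 0F ∷ q 1F ∷ q 2F ∷ q 3F ∷ [])
      (built-resp outside (λ o → o 0F ∷ o 1F ∷ o 2F ∷ o 3F ∷ [])
        (homogeneous {τ = bits e refs} (λ v → all? (λ i → ¬? (v ≟ q i))) M outside-M))
      where
      outside : ∀ {v} → All (v ≢_) (q 0F ∷ q 1F ∷ q 2F ∷ q 3F ∷ []) → Outside v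
      outside (a ∷ b ∷ c ∷ d ∷ []) = λ { 0F → a ; 1F → b ; 2F → c ; 3F → d }

-- Graphs with a triangle but no K₄

two-of-three : ∀ {a b c : Bool} → (a ∨ b) ≡ true → (a ∨ c) ≡ true → (b ∨ c) ≡ true →
               (a ≡ true × b ≡ true) ⊎ (a ≡ true × c ≡ true) ⊎ (b ≡ true × c ≡ true)
two-of-three {false}        b c _ = inj₂ (inj₂ (b , c))
two-of-three {true} {true}  _ _ _ = inj₁ (refl , refl)
two-of-three {true} {false} _ _ c = inj₂ (inj₁ (refl , c))

third : ∀ {i j : Fin 3} → i ≢ j → ∃ λ k → i ≢ k × j ≢ k
third {0F} {0F} ne = ⊥-elim (ne refl)
third {0F} {1F} ne = 2F , (λ ()) , (λ ())
third {0F} {2F} ne = 1F , (λ ()) , (λ ())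
third {1F} {0F} ne = 2F , (λ ()) , (λ ())
third {1F} {1F} ne = ⊥-elim (ne refl)
third {1F} {2F} ne = 0F , (λ ()) , (λ ())
third {2F} {0F} ne = 1F , (λ ()) , (λ ())
third {2F} {1F} ne = 0F , (λ ()) , (λ ())
third {2F} {2F} ne = ⊥-elim (ne refl)

module _ {n : ℕ} (𝒢 : Free n) where
  open Free 𝒢

  module ThreeClique (no-K₄ : ∀ {a b c d} → a ~ b → a ~ c → a ~ d → b ~ c → b ~ d → c ~ d → ⊥)
                  (q : Fin 3 → Fin n) (clique : ∀ {i j} → i ≢ j → q i ~ q j)
                  where

    maximal : ∀ {v} → ¬ (∀ i → v ~ q i)
    maximal v~q = no-K₄ (v~q 0F) (v~q 1F) (v~q 2F) (clique λ ()) (clique λ ()) (clique λ ())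

    open MaximalClique 𝒢 q clique maximal (q 0F)

    A : Fin 3 → Fin n → Set
    A i v = Outside v × q i ~ v

    A? : ∀ i v → Dec (A i v)
    A? i v = all? (λ k → ¬? (v ≟ q k)) ×-dec q i ~? v

    A-others : ∀ {i j v} → i ≢ j → A i v → q j ≁ v
    A-others i≢j (out , iv) = ¬~⇒≁ λ jv → one-neighbour out i≢j iv jv

    -- One vertex per class is sacrificed to make the class independent; an empty class defaults to
    -- q i, which is deleted anyway.
    a : Fin 3 → Fin n
    a i with any? (A? i)
    ... | yes (v , _) = v
    ... | no _        = q i

    S : Fin n → Set
    S v = Outside v × ∀ i → v ≢ a i

    S? : ∀ v → Dec (S v)
    S? v = all? (λ i → ¬? (v ≟ q i)) ×-dec all? (λ i → ¬? (v ≟ a i))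

    -- Suppose uv is an edge and w the sacrificed vertex. If w is adjacent to u or v,
    -- diamond-freeness turns q i, u, v, w into a K₄; otherwise w, uv and the other two triangle
    -- vertices form P₁ + 2P₂.
    A-independent : ∀ {i u v} → S u → S v → A i u → A i v → u ≁ v
    A-independent {i} {u} {v} (_ , u≢a) (_ , v≢a) Au Av with any? (A? i) | u≢a i | v≢a i
    ... | no none      | _    | _    = ⊥-elim (none (u , Au))
    ... | yes (w , Aw) | u≢w | v≢w = ¬~⇒≁ absurd
      where
      ⊆U : ∀ {x} → A i x → U (nxt i) (nxt (nxt i)) x
      ⊆U Ax@(out , _) = out , A-others (nxt≢ ∘ sym) Ax , A-others (nxt²≢ ∘ sym) Ax
      both : ∀ {u v} → A i u → A i v → u ~ v → v ≢ w → w ~ u → ⊥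
      both (_ , iu) (_ , iv) uv v≢w wu =
        no-K₄ iu iv (proj₂ Aw) uv (flip wu)
          (flip (no-diamond iu (proj₂ Aw) (flip wu) iv uv (v≢w ∘ sym)))
      absurd : u ~ v → ⊥
      absurd uv with edge? w u | edge? w v
      ... | inj₁ wu | _       = both Au Av uv v≢w wu
      ... | inj₂ _  | inj₁ wv = both Av Au (flip uv) u≢w wv
      ... | inj₂ wu | inj₂ wv = U-hit (nxt≢ ∘ sym) (⊆U Au) (⊆U Av) (⊆U Aw) uv wu wv

    -- The third triangle vertex misses both classes and would be the isolated vertex of a P₁ + 2P₂.
    A-chain : ∀ {i j x x′ y y′} → i ≢ j → S x → S x′ → S y → S y′ →
              A i x → A i x′ → A j y → A j y′ → x ~ y → x′ ~ y′ → x ≁ y′ → x′ ≁ y → ⊥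
    A-chain i≢j Sx Sx′ Sy Sy′ Ax Ax′ Ay Ay′ xy x′y′ xy′ x′y with third i≢j
    ... | k , i≢k , j≢k =
      no-P₁+2P₂ xy x′y′ (A-independent Sx Sx′ Ax Ax′) xy′ (flip x′y) (A-independent Sy Sy′ Ay Ay′)
        (A-others i≢k Ax) (A-others j≢k Ay) (A-others i≢k Ax′) (A-others j≢k Ay′)

    -- Otherwise the edges from q j to y and from x′ to z, with x isolated, form P₁ + 2P₂.
    transfer : ∀ {i j k x x′ y z} → i ≢ j → i ≢ k → j ≢ k → S x → S x′ →
               A i x → A i x′ → A j y → A k z → x ≁ y → x ≁ z → y ≁ z → x′ ~ z → x′ ~ y
    transfer ij ik jk Sx Sx′ Ax Ax′ Ay Az xy xz yz x′z = ¬≁⇒~ λ x′y →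
      no-P₁+2P₂ (proj₂ Ay) x′z (A-others ij Ax′) (A-others (jk ∘ sym) Az) (flip x′y) yz
        (flip (A-others ij Ax)) xy (A-independent Sx Sx′ Ax Ax′) xz

    ≢₀₁ : _≢_ {A = Fin 3} 0F 1F
    ≢₀₁ ()
    ≢₀₂ : _≢_ {A = Fin 3} 0F 2F
    ≢₀₂ ()
    ≢₁₂ : _≢_ {A = Fin 3} 1F 2F
    ≢₁₂ ()

    refs : ∀ {m} → Vec (Fin n) m → Vec (Fin n) _
    refs ts = q 0F ∷ q 1F ∷ q 2F ∷ rep ≢₀₁ ∷ rep ≢₀₂ ∷ rep ≢₁₂ ∷ ts

    M : ∀ {m} → (Vec Bool m → Vec Bool m → Bool) →
        Vec Bool (suc (suc (suc (suc (suc (suc m)))))) → Vec Bool (suc (suc (suc (suc (suc (suc m)))))) → Bool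
    M d (s₀ ∷ s₁ ∷ s₂ ∷ a ∷ b ∷ c ∷ s) (t₀ ∷ t₁ ∷ t₂ ∷ a′ ∷ b′ ∷ c′ ∷ t) =
      if (s₀ ∨ t₀) ∨ (s₁ ∨ t₁) then
      if (s₀ ∨ t₀) ∨ (s₂ ∨ t₂) then
      if (s₁ ∨ t₁) ∨ (s₂ ∨ t₂) then d s t
      else rule ≢₁₂ c c′
      else rule ≢₀₂ b b′
      else rule ≢₀₁ a a′

    -- The pairs of outside vertices for which every two triangle vertices include a blocked one;
    -- they are left to the argument d of `M`.
    Different : Fin n → Fin n → Set
    Different u v = ∃ λ i → ∃ λ j → i ≢ j × A i u × A j v

    outside-M : ∀ {m u v} (ts : Vec (Fin n) m) (d : Vec Bool m → Vec Bool m → Bool) →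
                Outside u → Outside v → u ≢ v →
                (Different u v → e u v ≡ d (bits e ts u) (bits e ts v)) →
                e u v ≡ M d (bits e (refs ts) u) (bits e (refs ts) v)
    outside-M {u = u} {v} ts d ou ov u≢v rest =
      if-cong (λ x₀₁ → if-cong (λ x₀₂ → if-cong
        (λ x₁₂ → rest (different x₀₁ x₀₂ x₁₂))
        (rule-correct ≢₁₂ ou ov u≢v)) (rule-correct ≢₀₂ ou ov u≢v)) (rule-correct ≢₀₁ ou ov u≢v)
      where
      b : Fin 3 → Bool
      b = blocked u v
      two-blocked : ∀ {i j} → i ≢ j → b i ≡ true → b j ≡ true → Different u v
      two-blocked ij bi bj with ∨-true bi | ∨-true bj
      ... | inj₁ x | inj₁ y = ⊥-elim (one-neighbour ou ij x y)
      ... | inj₁ x | inj₂ y = _ , _ , ij , (ou , x) , (ov , y)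
      ... | inj₂ x | inj₁ y = _ , _ , ij ∘ sym , (ou , y) , (ov , x)
      ... | inj₂ x | inj₂ y = ⊥-elim (one-neighbour ov ij x y)
      different : (b 0F ∨ b 1F) ≡ true → (b 0F ∨ b 2F) ≡ true → (b 1F ∨ b 2F) ≡ true → Different u v
      different p₀₁ p₀₂ p₁₂ with two-of-three p₀₁ p₀₂ p₁₂
      ... | inj₁ (x , y)        = two-blocked ≢₀₁ x y
      ... | inj₂ (inj₁ (x , y)) = two-blocked ≢₀₂ x y
      ... | inj₂ (inj₂ (x , y)) = two-blocked ≢₁₂ x y

    module IndependentTriple (t : Fin 3 → Fin n) (St : ∀ i → S (t i)) (At : ∀ i → A i (t i))
                             (t≁ : ∀ {i j} → i ≢ j → t i ≁ t j) where

      ts : Vec (Fin n) 3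
      ts = t 0F ∷ t 1F ∷ t 2F ∷ []

      -- By `cold` and `warm` a vertex sees either none of the triple or both members outside its
      -- class, so a single bit remains.
      hot : Vec Bool 3 → Bool
      hot (x ∷ y ∷ z ∷ []) = x ∨ (y ∨ z)

      hot-true : ∀ {u} i → t i ~ u → hot (bits e ts u) ≡ true
      hot-true 0F eq rewrite eq = refl
      hot-true {u} 1F eq rewrite eq = ∨-zeroʳ (e (t 0F) u)
      hot-true {u} 2F eq rewrite eq | ∨-zeroʳ (e (t 1F) u) = ∨-zeroʳ (e (t 0F) u)

      hot-false : ∀ {u} → (∀ i → t i ≁ u) → hot (bits e ts u) ≡ false
      hot-false f rewrite f 0F | f 1F | f 2F = refl

      cold : ∀ {i j u} → S u → A i u → i ≢ j → t j ≁ u → ∀ l → t l ≁ u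
      cold {i} {j} Su Au i≢j ju l with l ≟ i | l ≟ j
      ... | yes refl | _        = A-independent (St l) Su (At l) Au
      ... | no _     | yes refl = ju
      ... | no l≢i   | no l≢j   = ¬~⇒≁ λ lu →
        clash (transfer i≢j (l≢i ∘ sym) (l≢j ∘ sym) (St i) Su (At i) Au (At j) (At l)
                (t≁ i≢j) (t≁ (l≢i ∘ sym)) (t≁ (l≢j ∘ sym)) (flip lu)) (flip ju)

      warm : ∀ {i j u} → S u → A i u → i ≢ j → t j ~ u → ∀ {k} → i ≢ k → t k ~ u
      warm Su Au i≢j ju i≢k = ¬≁⇒~ λ ku → clash ju (cold Su Au i≢k ku _)

      -- If u is anticomplete to the triple, then it may replace the vertex of the
      -- triple in its own part.
      replace : ∀ {i j u v} → S u → S v → i ≢ j → A i u → A j v → t j ≁ u → t i ~ v → u ~ v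
      replace {i} {j} Su Sv i≢j Au Av ju iv with third i≢j
      ... | k , i≢k , j≢k =
        flip (transfer (i≢j ∘ sym) j≢k i≢k (St j) Sv (At j) Av Au (At k)
               ju (t≁ j≢k) (flip (cold Su Au i≢j ju k)) (flip (warm Sv Av (i≢j ∘ sym) iv j≢k)))

      -- If both are hot, a non-edge uv would make u t j and t i v an induced 2P₂. A cold vertex can
      -- stand in for the triple vertex of its class, which settles the other cases.
      different : ∀ {u v} → S u → S v → Different u v →
                  e u v ≡ hot (bits e ts u) ∨ hot (bits e ts v)
      different {u} {v} Su Sv (i , j , i≢j , Au , Av) with edge? (t j) u | edge? (t i) v
      ... | inj₁ ju | inj₁ iv rewrite hot-true {u} j ju =
        ¬≁⇒~ λ uv → A-chain i≢j Su (St i) (St j) Sv Au (At i) (At j) Av (flip ju) iv uv (t≁ i≢j)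
      ... | inj₁ ju | inj₂ iv rewrite hot-true {u} j ju = flip (replace Sv Su (i≢j ∘ sym) Av Au iv ju)
      ... | inj₂ ju | inj₁ iv rewrite hot-true {v} i iv | ∨-zeroʳ (hot (bits e ts u)) =
        replace Su Sv i≢j Au Av ju iv
      ... | inj₂ ju | inj₂ iv
        rewrite hot-false {u} (cold Su Au i≢j ju) | hot-false {v} (cold Sv Av (i≢j ∘ sym) iv) =
        ¬~⇒≁ absurd
        where
        absurd : u ~ v → ⊥
        absurd uv with third i≢j
        ... | k , i≢k , j≢k = clash
          (transfer j≢k (i≢j ∘ sym) (i≢k ∘ sym) (St j) Sv (At j) Av (At k) Au (t≁ j≢k) ju
            (cold Su Au i≢j ju k) (flip uv))
          (flip (cold Sv Av (i≢j ∘ sym) iv k))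

      triple-built : Built e (bits e (refs ts)) S
      triple-built = homogeneous S? (M both)
        (λ Su Sv u≢v → outside-M ts both (proj₁ Su) (proj₁ Sv) u≢v (different Su Sv))
        where
        both : Vec Bool 3 → Vec Bool 3 → Bool
        both s t = hot s ∨ hot t

    module NoIndependentTriple
      (none : ∀ {x y z} → S x → S y → S z → A 0F x → A 1F y → A 2F z → x ≁ y → y ≁ z → z ≁ x → ⊥)
      where

      -- Reads the class off the adjacency vector, as `refine` demands. Vertices missing the
      -- triangle also land in 2F, but they are not in `Touching`.
      class : Vec Bool 6 → Fin 3
      class (s₀ ∷ s₁ ∷ _) = if s₀ then 0F else if s₁ then 1F else 2F

      κ : Fin n → Fin 3
      κ v = class (bits e (refs []) v)

      Touching : Fin n → Set
      Touching v = S v × ∃ λ i → q i ~ v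

      κ-A : ∀ {i v} → A i v → κ v ≡ i
      κ-A {0F}     Av rewrite proj₂ Av = refl
      κ-A {1F} {v} Av rewrite A-others {j = 0F} (λ ()) Av | proj₂ Av = refl
      κ-A {2F} {v} Av rewrite A-others {j = 0F} (λ ()) Av | A-others {j = 1F} (λ ()) Av = refl

      A-κ : ∀ {v} → Touching v → A (κ v) v
      A-κ {v} ((out , _) , i , iv) = subst (λ j → A j v) (sym (κ-A (out , iv))) (out , iv)

      A-κ≡ : ∀ {v i} → Touching v → κ v ≡ i → A i v
      A-κ≡ {v} Tv eq = subst (λ j → A j v) eq (A-κ Tv)

      touching? : ∀ v → Dec (Touching v)
      touching? v = S? v ×-dec any? (λ i → q i ~? v)

      cyclic : Cyclic 𝒢 κ Touching
      cyclic = record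
        { part-independent = λ Tu Tv eq →
            A-independent (proj₁ Tu) (proj₁ Tv) (A-κ≡ Tu eq) (A-κ Tv)
        ; chains = λ {x} {x′} {y} {y′} Tx Tx′ Ty Ty′ xx′ yy′ xy x′y′ xy′ x′y →
            A-chain (λ eq → clash xy (A-independent (proj₁ Tx) (proj₁ Ty) (A-κ≡ Tx eq) (A-κ Ty)))
              (proj₁ Tx) (proj₁ Tx′) (proj₁ Ty) (proj₁ Ty′)
              (A-κ Tx) (A-κ≡ Tx′ (sym xx′)) (A-κ Ty) (A-κ≡ Ty′ (sym yy′)) xy x′y′ xy′ x′y
        ; no-independent = λ p q r Tu Tv Tw →
            none (proj₁ Tu) (proj₁ Tv) (proj₁ Tw) (A-κ≡ Tu p) (A-κ≡ Tv q) (A-κ≡ Tw r)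
        }

      no-triple-built : Built e (bits e (refs [])) S
      -- The constant `false` is a mere default: vertices of different classes both touch the
      -- triangle, and one endpoint here does not.
      no-triple-built = cut touching? (M (λ _ _ → false)) across
        (built-resp proj₂ (λ T → proj₁ T , T)
          (refine class (λ _ → refl) (cyclic-built 𝒢 κ Touching touching? cyclic)))
        (homogeneous (λ v → S? v ×-dec ¬? (touching? v)) (M (λ _ _ → false)) apart)
        where
        across : ∀ {u v} → S u → Touching u → S v → ¬ Touching v →
                 e u v ≡ M (λ _ _ → false) (bits e (refs []) u) (bits e (refs []) v)
        across Su Tu Sv ¬Tv = outside-M [] (λ _ _ → false) (proj₁ Su) (proj₁ Sv) (λ { refl → ¬Tv Tu })
          (λ (_ , j , _ , _ , Av) → ⊥-elim (¬Tv (Sv , j , proj₂ Av)))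
        apart : ∀ {u v} → S u × ¬ Touching u → S v × ¬ Touching v → u ≢ v →
                e u v ≡ M (λ _ _ → false) (bits e (refs []) u) (bits e (refs []) v)
        apart (Su , _) (Sv , ¬Tv) u≢v = outside-M [] (λ _ _ → false) (proj₁ Su) (proj₁ Sv) u≢v
          (λ (_ , j , _ , _ , Av) → ⊥-elim (¬Tv (Sv , j , proj₂ Av)))

    deleted : Vec (Fin n) 6
    deleted = q 0F ∷ q 1F ∷ q 2F ∷ a 0F ∷ a 1F ∷ a 2F ∷ []

    delete : ∀ {m} {rs : Vec (Fin n) m} → Built e (bits e rs) S → Typed 𝒢 (6 + m)
    delete b = add-all 𝒢 deleted (built-resp
      (λ { (x ∷ y ∷ z ∷ x′ ∷ y′ ∷ z′ ∷ []) →
             (λ { 0F → x ; 1F → y ; 2F → z }) , (λ { 0F → x′ ; 1F → y′ ; 2F → z′ }) })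
      (λ (out , ≢a) → out 0F ∷ out 1F ∷ out 2F ∷ ≢a 0F ∷ ≢a 1F ∷ ≢a 2F ∷ []) b)

    triangle-built : Typed 𝒢 15 ⊎ Typed 𝒢 12
    triangle-built with any? (λ x → any? (λ y → any? (λ z →
      (S? x ×-dec S? y ×-dec S? z) ×-dec (A? 0F x ×-dec A? 1F y ×-dec A? 2F z) ×-dec
      x ≁? y ×-dec y ≁? z ×-dec z ≁? x)))
    ... | no none = inj₂ (delete (NoIndependentTriple.no-triple-built
      λ Sx Sy Sz Ax Ay Az xy yz zx → none (_ , _ , _ , (Sx , Sy , Sz) , (Ax , Ay , Az) , xy , yz , zx)))
    ... | yes (x , y , z , (Sx , Sy , Sz) , (Ax , Ay , Az) , xy , yz , zx) =
      inj₁ (delete (IndependentTriple.triple-built t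
        (λ { 0F → Sx ; 1F → Sy ; 2F → Sz }) (λ { 0F → Ax ; 1F → Ay ; 2F → Az }) non-adjacent))
      where
      t : Fin 3 → Fin n
      t 0F = x
      t 1F = y
      t 2F = z
      non-adjacent : ∀ {i j} → i ≢ j → t i ≁ t j
      non-adjacent {0F} {0F} _ = e-irr x
      non-adjacent {0F} {1F} _ = xy
      non-adjacent {0F} {2F} _ = flip zx
      non-adjacent {1F} {0F} _ = flip xy
      non-adjacent {1F} {1F} _ = e-irr y
      non-adjacent {1F} {2F} _ = yz
      non-adjacent {2F} {0F} _ = zx
      non-adjacent {2F} {1F} _ = flip yz
      non-adjacent {2F} {2F} _ = e-irr z

-- Triangle-free graphs with a 5-cycle

Pattern : Set
Pattern = Vec Bool 5

none : Pattern
none = false ∷ false ∷ false ∷ false ∷ false ∷ []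

rotateᵇ reflectᵇ : Pattern → Pattern
rotateᵇ (a ∷ b ∷ c ∷ d ∷ f ∷ []) = b ∷ c ∷ d ∷ f ∷ a ∷ []
reflectᵇ (a ∷ b ∷ c ∷ d ∷ f ∷ []) = a ∷ f ∷ d ∷ c ∷ b ∷ []

-- The neighbourhoods {i} and {i - 1, i + 1} in a 5-cycle.
leaf twin : Fin 5 → Pattern
leaf 0F = true ∷ false ∷ false ∷ false ∷ false ∷ []
leaf 1F = false ∷ true ∷ false ∷ false ∷ false ∷ []
leaf 2F = false ∷ false ∷ true ∷ false ∷ false ∷ []
leaf 3F = false ∷ false ∷ false ∷ true ∷ false ∷ []
leaf 4F = false ∷ false ∷ false ∷ false ∷ true ∷ []
twin 0F = false ∷ true ∷ false ∷ false ∷ true ∷ []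
twin 1F = true ∷ false ∷ true ∷ false ∷ false ∷ []
twin 2F = false ∷ true ∷ false ∷ true ∷ false ∷ []
twin 3F = false ∷ false ∷ true ∷ false ∷ true ∷ []
twin 4F = true ∷ false ∷ false ∷ true ∷ false ∷ []

module _ {n : ℕ} (𝒢 : Free n) where
  open Free 𝒢

  -- Only the edges are recorded; the absence of chords follows from triangle-freeness through
  -- `share`.
  record C₅ : Set where
    field
      v₀ v₁ v₂ v₃ v₄ : Fin n
      e₀₁ : v₀ ~ v₁
      e₁₂ : v₁ ~ v₂
      e₂₃ : v₂ ~ v₃
      e₃₄ : v₃ ~ v₄
      e₄₀ : v₄ ~ v₀

    cycle : Vec (Fin n) 5
    cycle = v₀ ∷ v₁ ∷ v₂ ∷ v₃ ∷ v₄ ∷ []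

    pattern′ : Fin n → Pattern
    pattern′ = bits e cycle

  open C₅

  rotate₅ reflect₅ : C₅ → C₅
  rotate₅ c = record { v₀ = v₁ c ; v₁ = v₂ c ; v₂ = v₃ c ; v₃ = v₄ c ; v₄ = v₀ c
                     ; e₀₁ = e₁₂ c ; e₁₂ = e₂₃ c ; e₂₃ = e₃₄ c ; e₃₄ = e₄₀ c ; e₄₀ = e₀₁ c }
  reflect₅ c = record { v₀ = v₀ c ; v₁ = v₄ c ; v₂ = v₃ c ; v₃ = v₂ c ; v₄ = v₁ c
                      ; e₀₁ = flip (e₄₀ c) ; e₁₂ = flip (e₃₄ c) ; e₂₃ = flip (e₂₃ c)
                      ; e₃₄ = flip (e₁₂ c) ; e₄₀ = flip (e₀₁ c) }

  module TriangleFree (no-K₃ : ∀ {a b c} → a ~ b → a ~ c → b ~ c → ⊥) where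

    share : ∀ {w u v} → w ~ u → w ~ v → u ≁ v
    share wu wv = ¬~⇒≁ (no-K₃ wu wv)

    module Cycle (c : C₅) where

      Leaf Twin : Fin 5 → Fin n → Set
      Leaf i w = pattern′ c w ≡ leaf i
      Twin i w = pattern′ c w ≡ twin i

      Isolated : Fin n → Set
      Isolated w = pattern′ c w ≡ none

      infixl 9 _#_
      _#_ : ∀ {w p} → pattern′ c w ≡ p → ∀ i → lookup (pattern′ c w) i ≡ lookup p i
      eq # i = cong (λ b → lookup b i) eq

      c₀₂ : v₀ c ≁ v₂ c
      c₀₂ = share (flip (e₀₁ c)) (e₁₂ c)
      c₁₃ : v₁ c ≁ v₃ c
      c₁₃ = share (flip (e₁₂ c)) (e₂₃ c)
      c₂₄ : v₂ c ≁ v₄ c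
      c₂₄ = share (flip (e₂₃ c)) (e₃₄ c)
      c₃₀ : v₃ c ≁ v₀ c
      c₃₀ = share (flip (e₃₄ c)) (e₄₀ c)
      c₄₁ : v₄ c ≁ v₁ c
      c₄₁ = share (flip (e₄₀ c)) (e₀₁ c)

      -- This and the next lemmas fill up a P₁ + 2P₂ with vertices of the cycle. Each is stated in
      -- one position; rotations of the cycle give the others.
      isolated-isolated : ∀ {u w} → Isolated u → Isolated w → u ≁ w
      isolated-isolated U W = ¬~⇒≁ λ uw → no-P₁+2P₂ uw (e₀₁ c) (flip (U # 0F)) (flip (U # 1F))
        (flip (W # 0F)) (flip (W # 1F)) (U # 3F) (W # 3F) c₃₀ (flip c₁₃)

      isolated-leaf : ∀ {u w} → Isolated u → Leaf 0F w → u ≁ w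
      isolated-leaf U W = ¬~⇒≁ λ uw → no-P₁+2P₂ uw (e₁₂ c) (flip (U # 1F)) (flip (U # 2F))
        (flip (W # 1F)) (flip (W # 2F)) (U # 4F) (W # 4F) c₄₁ (flip c₂₄)

      isolated-twin : ∀ {u w} → Isolated u → Twin 2F w → u ≁ w
      isolated-twin U W = ¬~⇒≁ λ uw → no-P₁+2P₂ uw (e₄₀ c) (flip (U # 4F)) (flip (U # 0F))
        (flip (W # 4F)) (flip (W # 0F)) (U # 2F) (W # 2F) c₂₄ (flip c₀₂)

      leaf-leaf₁ : ∀ {u w} → Leaf 0F u → Leaf 1F w → u ~ w
      leaf-leaf₁ U W = ¬≁⇒~ λ uw → no-P₁+2P₂ (flip (U # 0F)) (e₂₃ c) (flip (U # 2F)) (flip (U # 3F))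
        c₀₂ (flip c₃₀) (flip uw) (flip (W # 0F)) (flip (W # 2F)) (flip (W # 3F))

      leaf-leaf₂ : ∀ {u w} → Leaf 0F u → Leaf 2F w → u ≁ w
      leaf-leaf₂ U W = ¬~⇒≁ λ uw → no-P₁+2P₂ uw (e₃₄ c) (flip (U # 3F)) (flip (U # 4F))
        (flip (W # 3F)) (flip (W # 4F)) (U # 1F) (W # 1F) c₁₃ (flip c₄₁)

      leaf-twin : ∀ {u w} → Leaf 0F u → Twin 0F w → u ~ w
      leaf-twin U W = ¬≁⇒~ λ uw → no-P₁+2P₂ (flip (U # 0F)) (e₂₃ c) (flip (U # 2F)) (flip (U # 3F))
        c₀₂ (flip c₃₀) (flip uw) (flip (W # 0F)) (flip (W # 2F)) (flip (W # 3F))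

      leaf-twin-twin : ∀ {s d d′} → Leaf 0F s → Twin 2F d → Twin 3F d′ → s ≁ d → d ≁ d′ → d′ ≁ s → ⊥
      leaf-twin-twin s d d′ sd dd′ d′s = no-P₁+2P₂ (flip (s # 0F)) (flip (d # 3F)) sd (flip (s # 3F))
        (d # 0F) (flip c₃₀) d′s (flip (d′ # 0F)) (flip dd′) (flip (d′ # 3F))

      twin-twin-twin : ∀ {x y z} → Twin 1F x → Twin 2F y → Twin 3F z → x ≁ y → y ≁ z → ⊥
      twin-twin-twin X Y Z xy yz = no-P₁+2P₂ (flip (X # 0F)) (flip (Y # 3F)) xy (flip (X # 3F))
        (Y # 0F) (flip c₃₀) (share (Z # 2F) (X # 2F)) (flip (Z # 0F)) (flip yz) (flip (Z # 3F))

      leaf-twin₁₂ : ∀ {s x y} → Leaf 0F s → Twin 1F x → Twin 2F y → s ~ y → x ≁ y → ⊥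
      leaf-twin₁₂ S X Y sy xy = no-P₁+2P₂ sy (flip (X # 2F)) (share (S # 0F) (X # 0F)) (flip (S # 2F))
        (flip xy) (flip (Y # 2F)) (S # 4F) (Y # 4F) (X # 4F) (flip c₂₄)

      leaf-twin₂₃ : ∀ {s x y} → Leaf 4F s → Twin 2F x → Twin 3F y → s ~ x → x ≁ y → ⊥
      leaf-twin₂₃ S X Y sx xy = no-P₁+2P₂ sx (flip (Y # 2F)) (share (S # 4F) (Y # 4F)) (flip (S # 2F))
        xy (flip (X # 2F)) (S # 0F) (X # 0F) (Y # 0F) c₀₂

      -- Neighbourhoods on the cycle are independent sets of it, which leaves these shapes. The
      -- cycle vertices themselves are twins.
      Kind : Fin n → Set
      Kind w = Isolated w ⊎ (∃ λ i → Leaf i w) ⊎ (∃ λ i → Twin i w)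

      kind : ∀ w → Kind w
      kind w with e (v₀ c) w in a | e (v₁ c) w in b | e (v₂ c) w in d | e (v₃ c) w in f | e (v₄ c) w in g
      ... | true  | true  | _     | _     | _     = ⊥-elim (no-K₃ (e₀₁ c) a b)
      ... | _     | true  | true  | _     | _     = ⊥-elim (no-K₃ (e₁₂ c) b d)
      ... | _     | _     | true  | true  | _     = ⊥-elim (no-K₃ (e₂₃ c) d f)
      ... | _     | _     | _     | true  | true  = ⊥-elim (no-K₃ (e₃₄ c) f g)
      ... | true  | _     | _     | _     | true  = ⊥-elim (no-K₃ (e₄₀ c) g a)
      ... | false | false | false | false | false = inj₁ refl
      ... | true  | false | false | false | false = inj₂ (inj₁ (0F , refl))
      ... | false | true  | false | false | false = inj₂ (inj₁ (1F , refl))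
      ... | false | false | true  | false | false = inj₂ (inj₁ (2F , refl))
      ... | false | false | false | true  | false = inj₂ (inj₁ (3F , refl))
      ... | false | false | false | false | true  = inj₂ (inj₁ (4F , refl))
      ... | false | true  | false | false | true  = inj₂ (inj₂ (0F , refl))
      ... | true  | false | true  | false | false = inj₂ (inj₂ (1F , refl))
      ... | false | true  | false | true  | false = inj₂ (inj₂ (2F , refl))
      ... | false | false | true  | false | true  = inj₂ (inj₂ (3F , refl))
      ... | true  | false | false | true  | false = inj₂ (inj₂ (4F , refl))

      -- Generically the twins at 2F and 3F are complete to each other and miss the leaves at 0F.
      -- `E` and `E′` collect the exceptional twins.
      E E′ Block : Fin n → Set
      E w     = Twin 2F w × ∃ λ z → (Twin 3F z × w ≁ z) ⊎ (Leaf 0F z × w ~ z)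
      E′ w    = Twin 3F w × ∃ λ z → (Twin 2F z × w ≁ z) ⊎ (Leaf 0F z × w ~ z)
      Block w = Leaf 0F w ⊎ E w ⊎ E′ w

      infix 4 _≟ᵖ_
      _≟ᵖ_ : (p q : Pattern) → Dec (p ≡ q)
      _≟ᵖ_ = ≡-dec _≟ᵇ_

      block? : ∀ w → Dec (Block w)
      block? w = (pattern′ c w ≟ᵖ leaf 0F) ⊎-dec
        (((pattern′ c w ≟ᵖ twin 2F) ×-dec any? (λ z →
           ((pattern′ c z ≟ᵖ twin 3F) ×-dec (w ≁? z)) ⊎-dec ((pattern′ c z ≟ᵖ leaf 0F) ×-dec (w ~? z)))) ⊎-dec
         ((pattern′ c w ≟ᵖ twin 3F) ×-dec any? (λ z →
           ((pattern′ c z ≟ᵖ twin 2F) ×-dec (w ≁? z)) ⊎-dec ((pattern′ c z ≟ᵖ leaf 0F) ×-dec (w ~? z)))))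

      part : Fin 3 → Pattern
      part 0F = leaf 0F
      part 1F = twin 2F
      part 2F = twin 3F

      class : Pattern → Fin 3
      class (a ∷ b ∷ _) = if a then 0F else if b then 1F else 2F

      κ : Fin n → Fin 3
      κ w = class (pattern′ c w)

      Part : Fin 3 → Fin n → Set
      Part i w = pattern′ c w ≡ part i

      block-part : ∀ {w} → Block w → Part (κ w) w
      block-part (inj₁ p)              = trans p (cong (part ∘ class) (sym p))
      block-part (inj₂ (inj₁ (p , _))) = trans p (cong (part ∘ class) (sym p))
      block-part (inj₂ (inj₂ (p , _))) = trans p (cong (part ∘ class) (sym p))

      block-part≡ : ∀ {w i} → Block w → κ w ≡ i → Part i w
      block-part≡ {w} B eq = subst (λ i → Part i w) eq (block-part B)

      part-part : ∀ {i u w} → Part i u → Part i w → u ≁ w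
      part-part {0F} p q = share (p # 0F) (q # 0F)
      part-part {1F} p q = share (p # 1F) (q # 1F)
      part-part {2F} p q = share (p # 2F) (q # 2F)

      -- Supplies the isolated vertex that turns an induced 2P₂ between two parts into P₁ + 2P₂.
      far : ∀ {i j} → i ≢ j → ∃ λ x → (∀ {w} → Part i w → x ≁ w) × (∀ {w} → Part j w → x ≁ w)
      far {0F} {0F} ne = ⊥-elim (ne refl)
      far {0F} {1F} ne = v₄ c , (_# 4F) , (_# 4F)
      far {0F} {2F} ne = v₁ c , (_# 1F) , (_# 1F)
      far {1F} {0F} ne = v₄ c , (_# 4F) , (_# 4F)
      far {1F} {1F} ne = ⊥-elim (ne refl)
      far {1F} {2F} ne = v₀ c , (_# 0F) , (_# 0F)
      far {2F} {0F} ne = v₁ c , (_# 1F) , (_# 1F)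
      far {2F} {1F} ne = v₀ c , (_# 0F) , (_# 0F)
      far {2F} {2F} ne = ⊥-elim (ne refl)

      part-chain : ∀ {i j x x′ y y′} → Part i x → Part i x′ → Part j y → Part j y′ →
                   x ~ y → x′ ~ y′ → x ≁ y′ → x′ ≁ y → ⊥
      part-chain {i} {j} {x} {x′} {y} {y′} Px Px′ Py Py′ xy x′y′ xy′ x′y with i ≟ j
      ... | yes refl = clash xy (part-part {i} {x} {y} Px Py)
      ... | no i≢j with far i≢j
      ...   | p , pi , pj = no-P₁+2P₂ xy x′y′ (part-part {i} Px Px′) xy′ (flip x′y) (part-part {j} Py Py′)
                              (pi Px) (pj Py) (pi Px′) (pj Py′)

      block-cyclic : Cyclic 𝒢 κ Block
      block-cyclic = record
        { part-independent = λ Bu Bv eq → part-part {κ _} (block-part≡ Bu eq) (block-part Bv)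
        ; chains = λ Bx Bx′ By By′ xx′ yy′ → part-chain {κ _} {κ _} (block-part Bx) (block-part≡ Bx′ (sym xx′))
                                               (block-part By) (block-part≡ By′ (sym yy′))
        ; no-independent = λ p q r Bu Bv Bw →
            leaf-twin-twin (block-part≡ Bu p) (block-part≡ Bv q) (block-part≡ Bw r)
        }

      block-built : ∀ {X} → (∀ v → Dec (X v)) → (∀ {v} → X v → Block v) → Built e (pattern′ c) X
      block-built X? X⊆B = refine class (λ _ → refl)
        (cyclic-built 𝒢 κ _ X? (cyclic-mono 𝒢 κ X⊆B block-cyclic))

    infixl 9 _↻_
    _↻_ : C₅ → ℕ → C₅
    c ↻ 0     = c
    c ↻ suc k = rotate₅ (c ↻ k)

    -- The action of `_↻_` on patterns; the two agree by computation.
    turn : ℕ → Pattern → Pattern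
    turn 0       p = p
    turn (suc k) p = rotateᵇ (turn k p)

    module _ (c : C₅) where
      open Cycle c

      extension≁leaf : ∀ {u w} → E u → Leaf 4F w → u ≁ w
      extension≁leaf (U , z , inj₁ (Z , uz)) W = ¬~⇒≁ λ uw → leaf-twin₂₃ W U Z (flip uw) uz
      extension≁leaf (U , z , inj₂ (Z , uz)) W = ¬~⇒≁ λ uw → no-K₃ uw uz
        (Cycle.leaf-leaf₁ (c ↻ 4) (cong (turn 4) W) (cong (turn 4) Z))

      extension~twin : ∀ {u w} → E u → Twin 1F w → u ~ w
      extension~twin (U , z , inj₁ (Z , uz)) W = ¬≁⇒~ λ uw → twin-twin-twin W U Z (flip uw) uz
      extension~twin (U , z , inj₂ (Z , uz)) W = ¬≁⇒~ λ uw → leaf-twin₁₂ Z W U (flip uz) (flip uw)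

      -- An exceptional twin looks like v₂ from outside its block: the witness of its exception
      -- rules out deviations towards leaves at 4F and twins at 1F.
      extension-cross : ∀ {u w} → E u → ¬ Leaf 0F w → ¬ E′ w → e u w ≡ e (v₂ c) w
      extension-cross {u} {w} Eu@(U , _) ¬L ¬E′ with kind w
      ... | inj₁ W                = trans (flip (isolated-twin W U)) (sym (W # 2F))
      ... | inj₂ (inj₁ (0F , W))  = ⊥-elim (¬L W)
      ... | inj₂ (inj₁ (1F , W))  = trans (share (U # 1F) (W # 1F)) (sym (W # 2F))
      ... | inj₂ (inj₁ (2F , W))  =
        trans (flip (Cycle.leaf-twin (c ↻ 2) (cong (turn 2) W) (cong (turn 2) U))) (sym (W # 2F))
      ... | inj₂ (inj₁ (3F , W))  = trans (share (U # 3F) (W # 3F)) (sym (W # 2F))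
      ... | inj₂ (inj₁ (4F , W))  = trans (extension≁leaf Eu W) (sym (W # 2F))
      ... | inj₂ (inj₂ (0F , W))  = trans (share (U # 1F) (W # 1F)) (sym (W # 2F))
      ... | inj₂ (inj₂ (1F , W))  = trans (extension~twin Eu W) (sym (W # 2F))
      ... | inj₂ (inj₂ (2F , W))  = trans (share (U # 1F) (W # 1F)) (sym (W # 2F))
      ... | inj₂ (inj₂ (3F , W))  =
        trans (¬≁⇒~ λ uw → ¬E′ (W , u , inj₁ (U , flip uw))) (sym (W # 2F))
      ... | inj₂ (inj₂ (4F , W))  = trans (share (U # 3F) (W # 3F)) (sym (W # 2F))

      -- Among the patterns that occur, this picks out the leaves at 1F and 4F and the twins at 0F.
      leaf-rule : Pattern → Bool
      leaf-rule (_ ∷ a ∷ b ∷ d ∷ f ∷ []) = (a ∨ f) ∧ not (b ∨ d)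

      leaf-cross : ∀ {u w} → Leaf 0F u → ¬ Block w → e u w ≡ leaf-rule (pattern′ c w)
      leaf-cross {u} {w} U ¬B with kind w
      ... | inj₁ W                = trans (flip (isolated-leaf W U)) (sym (cong leaf-rule W))
      ... | inj₂ (inj₁ (0F , W))  = ⊥-elim (¬B (inj₁ W))
      ... | inj₂ (inj₁ (1F , W))  = trans (leaf-leaf₁ U W) (sym (cong leaf-rule W))
      ... | inj₂ (inj₁ (2F , W))  = trans (leaf-leaf₂ U W) (sym (cong leaf-rule W))
      ... | inj₂ (inj₁ (3F , W))  =
        trans (flip (Cycle.leaf-leaf₂ (c ↻ 3) (cong (turn 3) W) (cong (turn 3) U))) (sym (cong leaf-rule W))
      ... | inj₂ (inj₁ (4F , W))  =
        trans (flip (Cycle.leaf-leaf₁ (c ↻ 4) (cong (turn 4) W) (cong (turn 4) U))) (sym (cong leaf-rule W))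
      ... | inj₂ (inj₂ (0F , W))  = trans (leaf-twin U W) (sym (cong leaf-rule W))
      ... | inj₂ (inj₂ (1F , W))  = trans (share (U # 0F) (W # 0F)) (sym (cong leaf-rule W))
      ... | inj₂ (inj₂ (2F , W))  = trans
        (¬~⇒≁ λ uw → ¬B (inj₂ (inj₁ (W , u , inj₂ (U , flip uw))))) (sym (cong leaf-rule W))
      ... | inj₂ (inj₂ (3F , W))  = trans
        (¬~⇒≁ λ uw → ¬B (inj₂ (inj₂ (W , u , inj₂ (U , flip uw))))) (sym (cong leaf-rule W))
      ... | inj₂ (inj₂ (4F , W))  = trans (share (U # 0F) (W # 0F)) (sym (cong leaf-rule W))

    module _ (c : C₅) where
      open Cycle c
      private module Mirror = Cycle (reflect₅ c)

      -- Reflection in v₀ exchanges v₂ and v₃, so one half of the block needs no separate analysis.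
      to-mirror : ∀ {w} → E′ w → Mirror.E w
      to-mirror (W , z , inj₁ (Z , x)) = cong reflectᵇ W , z , inj₁ (cong reflectᵇ Z , x)
      to-mirror (W , z , inj₂ (Z , x)) = cong reflectᵇ W , z , inj₂ (cong reflectᵇ Z , x)

      from-mirror : ∀ {w} → Mirror.E′ w → E w
      from-mirror (W , z , inj₁ (Z , x)) = cong reflectᵇ W , z , inj₁ (cong reflectᵇ Z , x)
      from-mirror (W , z , inj₂ (Z , x)) = cong reflectᵇ W , z , inj₂ (cong reflectᵇ Z , x)

      block-rule : Pattern → Pattern → Bool
      block-rule (a ∷ b ∷ _) t@(_ ∷ _ ∷ x ∷ y ∷ _) = if a then leaf-rule c t else if b then x else y

      block-cross : ∀ {u w} → Block u → ¬ Block w →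
                    e u w ≡ block-rule (pattern′ c u) (pattern′ c w)
      block-cross {w = w} (inj₁ U) ¬B =
        trans (leaf-cross c U ¬B) (sym (cong (λ s → block-rule s (pattern′ c w)) U))
      block-cross {w = w} (inj₂ (inj₁ Eu)) ¬B =
        trans (extension-cross c Eu (¬B ∘ inj₁) (¬B ∘ inj₂ ∘ inj₂))
              (sym (cong (λ s → block-rule s (pattern′ c w)) (proj₁ Eu)))
      block-cross {w = w} (inj₂ (inj₂ E′u)) ¬B =
        trans (extension-cross (reflect₅ c) (to-mirror E′u)
                (¬B ∘ inj₁ ∘ cong reflectᵇ) (¬B ∘ inj₂ ∘ inj₁ ∘ from-mirror))
              (sym (cong (λ s → block-rule s (pattern′ c w)) (proj₁ E′u)))

    module _ (c : C₅) where
      open Cycle c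

      peel : ∀ k → (∀ {w} → pattern′ (c ↻ k) w ≡ turn k (pattern′ c w)) →
             ∀ {X} → (∀ v → Dec (X v)) →
             Built e (pattern′ c) (λ v → X v × ¬ Cycle.Block (c ↻ k) v) → Built e (pattern′ c) X
      peel k turned X? rest = cut (Cycle.block? (c ↻ k))
        (λ s t → block-rule (c ↻ k) (turn k s) (turn k t))
        (λ _ B _ ¬B → trans (block-cross (c ↻ k) B ¬B) (cong₂ (block-rule (c ↻ k)) turned turned))
        (refine (turn k) (λ _ → turned)
          (Cycle.block-built (c ↻ k) (λ v → X? v ×-dec Cycle.block? (c ↻ k) v) proj₂))
        rest

      Rest : Fin n → Set
      Rest v = ((((⊤ × ¬ Block v) × ¬ Cycle.Block (c ↻ 1) v) × ¬ Cycle.Block (c ↻ 2) v) ×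
                ¬ Cycle.Block (c ↻ 3) v) × ¬ Cycle.Block (c ↻ 4) v

      rest-leaf : ∀ i {w} → Rest w → ¬ Leaf i w
      rest-leaf 0F (((((_ , ¬B) , _) , _) , _) , _) W = ¬B (inj₁ W)
      rest-leaf 1F ((((_ , ¬B) , _) , _) , _) W       = ¬B (inj₁ (cong (turn 1) W))
      rest-leaf 2F (((_ , ¬B) , _) , _) W             = ¬B (inj₁ (cong (turn 2) W))
      rest-leaf 3F ((_ , ¬B) , _) W                   = ¬B (inj₁ (cong (turn 3) W))
      rest-leaf 4F (_ , ¬B) W                         = ¬B (inj₁ (cong (turn 4) W))

      -- What remains is a blown-up 5-cycle with isolated vertices: twins are adjacent exactly when
      -- their neighbourhoods on the cycle are disjoint.
      rest-rule : Pattern → Pattern → Bool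
      rest-rule s t = or s ∧ (or t ∧ not (or (zipWith _∧_ s t)))
        where
        or : Pattern → Bool
        or = foldr′ _∨_ false

    twins : (c : C₅) → ∀ {u w} → Cycle.Twin c 2F u → Cycle.Twin c 3F w → ¬ Cycle.Block c u → u ~ w
    twins c U W ¬B = ¬≁⇒~ λ uw → ¬B (inj₂ (inj₁ (U , _ , inj₁ (W , uw))))

    module _ (c : C₅) where
      open Cycle c

      isolated-twins : ∀ i {u w} → Isolated u → Twin i w → u ≁ w
      isolated-twins 0F U W = Cycle.isolated-twin (c ↻ 3) (cong (turn 3) U) (cong (turn 3) W)
      isolated-twins 1F U W = Cycle.isolated-twin (c ↻ 4) (cong (turn 4) U) (cong (turn 4) W)
      isolated-twins 2F U W = isolated-twin U W
      isolated-twins 3F U W = Cycle.isolated-twin (c ↻ 1) (cong (turn 1) U) (cong (turn 1) W)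
      isolated-twins 4F U W = Cycle.isolated-twin (c ↻ 2) (cong (turn 2) U) (cong (turn 2) W)

      consecutive : ∀ i j {u w} → Twin i u → Twin j w → Rest c u → Rest c w →
                    e u w ≡ rest-rule c (twin i) (twin j)
      consecutive 0F 0F U W _ _ = share (U # 1F) (W # 1F)
      consecutive 0F 2F U W _ _ = share (U # 1F) (W # 1F)
      consecutive 0F 3F U W _ _ = share (U # 4F) (W # 4F)
      consecutive 1F 1F U W _ _ = share (U # 0F) (W # 0F)
      consecutive 1F 3F U W _ _ = share (U # 2F) (W # 2F)
      consecutive 1F 4F U W _ _ = share (U # 0F) (W # 0F)
      consecutive 2F 0F U W _ _ = share (U # 1F) (W # 1F)
      consecutive 2F 2F U W _ _ = share (U # 1F) (W # 1F)
      consecutive 2F 4F U W _ _ = share (U # 3F) (W # 3F)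
      consecutive 3F 0F U W _ _ = share (U # 4F) (W # 4F)
      consecutive 3F 1F U W _ _ = share (U # 2F) (W # 2F)
      consecutive 3F 3F U W _ _ = share (U # 2F) (W # 2F)
      consecutive 4F 1F U W _ _ = share (U # 0F) (W # 0F)
      consecutive 4F 2F U W _ _ = share (U # 3F) (W # 3F)
      consecutive 4F 4F U W _ _ = share (U # 0F) (W # 0F)
      consecutive 0F 1F U W (((_ , ¬B) , _)) _ = twins (c ↻ 3) (cong (turn 3) U) (cong (turn 3) W) ¬B
      consecutive 1F 2F U W (_ , ¬B) _ = twins (c ↻ 4) (cong (turn 4) U) (cong (turn 4) W) ¬B
      consecutive 2F 3F U W (((((_ , ¬B) , _) , _) , _) , _) _ = twins c U W ¬B
      consecutive 3F 4F U W ((((_ , ¬B) , _) , _) , _) _ = twins (c ↻ 1) (cong (turn 1) U) (cong (turn 1) W) ¬B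
      consecutive 4F 0F U W (((_ , ¬B) , _) , _) _ = twins (c ↻ 2) (cong (turn 2) U) (cong (turn 2) W) ¬B
      consecutive 1F 0F U W RU RW = flip (consecutive 0F 1F W U RW RU)
      consecutive 2F 1F U W RU RW = flip (consecutive 1F 2F W U RW RU)
      consecutive 3F 2F U W RU RW = flip (consecutive 2F 3F W U RW RU)
      consecutive 4F 3F U W RU RW = flip (consecutive 3F 4F W U RW RU)
      consecutive 0F 4F U W RU RW = flip (consecutive 4F 0F W U RW RU)

      twin-none : ∀ i → rest-rule c (twin i) none ≡ false
      twin-none 0F = refl
      twin-none 1F = refl
      twin-none 2F = refl
      twin-none 3F = refl
      twin-none 4F = refl

      rest-cross : ∀ {u w} → Rest c u → Rest c w → e u w ≡ rest-rule c (pattern′ c u) (pattern′ c w)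
      rest-cross {u} {w} RU RW with kind u | kind w
      ... | inj₂ (inj₁ (i , U)) | _                   = ⊥-elim (rest-leaf c i RU U)
      ... | _                   | inj₂ (inj₁ (j , W)) = ⊥-elim (rest-leaf c j RW W)
      ... | inj₁ U              | inj₁ W              =
        trans (isolated-isolated U W) (sym (cong₂ (rest-rule c) U W))
      ... | inj₁ U              | inj₂ (inj₂ (j , W)) =
        trans (isolated-twins j U W) (sym (cong₂ (rest-rule c) U W))
      ... | inj₂ (inj₂ (i , U)) | inj₁ W              =
        trans (flip (isolated-twins i W U)) (sym (trans (cong₂ (rest-rule c) U W) (twin-none i)))
      ... | inj₂ (inj₂ (i , U)) | inj₂ (inj₂ (j , W)) =
        trans (consecutive i j U W RU RW) (sym (cong₂ (rest-rule c) U W))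

      five-cycle-built : Typed 𝒢 5
      five-cycle-built = pattern′ c ,
        peel c 0 refl d₀ (peel c 1 refl d₁ (peel c 2 refl d₂ (peel c 3 refl d₃ (peel c 4 refl d₄
          (homogeneous (λ v → d₄ v ×-dec ¬? (Cycle.block? (c ↻ 4) v)) (rest-rule c)
            (λ RU RW _ → rest-cross RU RW))))))
        where
        d₀ = λ (v : Fin n) → yes tt
        d₁ = λ v → d₀ v ×-dec ¬? (Cycle.block? c v)
        d₂ = λ v → d₁ v ×-dec ¬? (Cycle.block? (c ↻ 1) v)
        d₃ = λ v → d₂ v ×-dec ¬? (Cycle.block? (c ↻ 2) v)
        d₄ = λ v → d₃ v ×-dec ¬? (Cycle.block? (c ↻ 3) v)

-- Graphs without triangles and 5-cycles

module _ {n : ℕ} (𝒢 : Free n) where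
  open Free 𝒢

  module OddGirth (no-K₃ : ∀ {a b c} → a ~ b → a ~ c → b ~ c → ⊥) (no-C₅ : ¬ C₅ 𝒢) where
    open TriangleFree 𝒢 no-K₃ using (share)

    pentagon : ∀ {a b c d f} → a ~ b → b ~ c → c ~ d → d ~ f → f ~ a → ⊥
    pentagon ab bc cd df fa = no-C₅ (record { e₀₁ = ab ; e₁₂ = bc ; e₂₃ = cd ; e₃₄ = df ; e₄₀ = fa })

    module _ {x y} (xy : x ~ y) where

      Far : Fin n → Set
      Far v = x ≁ v × y ≁ v

      far? : ∀ v → Dec (Far v)
      far? v = x ≁? v ×-dec y ≁? v

      Touches : Fin n → Fin n → Set
      Touches v z = ∃ λ w → z ~ w × v ~ w

      touches? : ∀ v z → Dec (Touches v z)
      touches? v z = any? (λ w → z ~? w ×-dec v ~? w)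

      data Position (v : Fin n) : Set where
        at-x : x ~ v → y ≁ v → Position v
        at-y : x ≁ v → y ~ v → Position v
        far  : Far v → Position v

      position : ∀ v → Position v
      position v with edge? x v | edge? y v
      ... | inj₁ xv | inj₁ yv = ⊥-elim (no-K₃ xy xv yv)
      ... | inj₁ xv | inj₂ yv = at-x xv yv
      ... | inj₂ xv | inj₁ yv = at-y xv yv
      ... | inj₂ xv | inj₂ yv = far (xv , yv)

      far-hit : ∀ {u v w} → Far u → Far v → Far w → u ~ v → w ≁ u → w ≁ v → ⊥
      far-hit (xu , yu) (xv , yv) (xw , yw) uv wu wv =
        no-P₁+2P₂ uv xy (flip xu) (flip yu) (flip xv) (flip yv) wu wv (flip xw) (flip yw)

      not-both-touch : ∀ {v} → Touches v x → Touches v y → ⊥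
      not-both-touch (a , xa , va) (b , yb , vb) = pentagon xa (flip va) vb (flip yb) (flip xy)

      -- The neighbours of x are coloured `true` and those of y `false`, so a far vertex must avoid
      -- the colour of the neighbourhood it touches.
      bipartite : (side : Fin n → Bool) →
                  (∀ {u v} → Far u → Far v → side u ≡ side v → u ≁ v) →
                  (∀ {v} → Far v → side v ≡ true → ¬ Touches v x) →
                  (∀ {v} → Far v → side v ≡ false → ¬ Touches v y) → Typed 𝒢 1
      bipartite side independent true-side false-side =
        (λ v → col v ∷ []) , refine (λ b → lookup b 0F) (λ _ → refl)
          (bipartite-built 𝒢 col _ (λ _ → yes tt) (λ _ _ → proper))
        where
        col : Fin n → Bool
        col v = if e x v then true else if e y v then false else side v
        far-col : ∀ {v} → Far v → col v ≡ side v
        far-col (xv , yv) rewrite xv | yv = refl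
        x-col : ∀ {v} → x ~ v → col v ≡ true
        x-col xv rewrite xv = refl
        y-col : ∀ {v} → x ≁ v → y ~ v → col v ≡ false
        y-col xv yv rewrite xv | yv = refl
        distinct : ∀ {b : Bool} → b ≡ true → b ≡ false → ⊥
        distinct refl ()
        proper : ∀ {u v} → col u ≡ col v → u ≁ v
        proper {u} {v} eq with position u | position v
        ... | at-x xu _  | at-x xv _  = share xu xv
        ... | at-y _ yu  | at-y _ yv  = share yu yv
        ... | far fu     | far fv     = independent fu fv (trans (sym (far-col fu)) (trans eq (far-col fv)))
        ... | at-x xu _  | at-y xv yv = ⊥-elim (distinct (x-col xu) (trans eq (y-col xv yv)))
        ... | at-y xu yu | at-x xv _  = ⊥-elim (distinct (x-col xv) (trans (sym eq) (y-col xu yu)))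
        ... | at-x xu _  | far fv     = ¬~⇒≁ λ uv →
              true-side fv (trans (sym (far-col fv)) (trans (sym eq) (x-col xu))) (u , xu , flip uv)
        ... | far fu     | at-x xv _  = ¬~⇒≁ λ uv →
              true-side fu (trans (sym (far-col fu)) (trans eq (x-col xv))) (v , xv , uv)
        ... | at-y xu yu | far fv     = ¬~⇒≁ λ uv →
              false-side fv (trans (sym (far-col fv)) (trans (sym eq) (y-col xu yu))) (u , yu , flip uv)
        ... | far fu     | at-y xv yv = ¬~⇒≁ λ uv →
              false-side fu (trans (sym (far-col fu)) (trans eq (y-col xv yv))) (v , yv , uv)

    -- With p and p′ adjacent and far from x and y, the vertices far from x and y
    -- form a complete bipartite graph.
    module FarEdge {x y} (xy : x ~ y) {p p′} (Fp : Far xy p) (Fp′ : Far xy p′) (pp′ : p ~ p′) where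

      far-independent : ∀ {u v} → Far xy u → Far xy v → e p u ≡ e p v → u ≁ v
      far-independent {u} {v} Fu Fv eq with edge? p u
      ... | inj₁ pu = share pu (trans (sym eq) pu)
      ... | inj₂ pu = ¬~⇒≁ λ uv → far-hit xy Fu Fv Fp uv pu (trans (sym eq) pu)

      far-complete : ∀ {u v} → Far xy u → Far xy v → p ≁ u → p ~ v → u ~ v
      far-complete {u} {v} Fu Fv pu pv = ¬≁⇒~ λ uv →
        far-hit xy Fu Fp′ Fv (¬≁⇒~ λ up′ → far-hit xy Fp Fp′ Fu pp′ (flip pu) up′)
          (flip uv) (share pv pp′)

      -- Opposite sides of the far graph are completely joined, so the two paths to z would close up
      -- to a 5-cycle.
      touching : ∀ {u v} z → Far xy u → Far xy v → p ≁ u → p ~ v →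
                 Touches xy u z → Touches xy v z → ⊥
      touching z Fu Fv pu pv (a , za , ua) (b , zb , vb) =
        pentagon za (flip ua) (far-complete Fu Fv pu pv) vb (flip zb)

    -- The 7-cycle is x, a, p₁, p′, p₂, b, y. Exchanging x with y turns the facts on neighbours of x
    -- into those on neighbours of y.
    module HalfHeptagon {x y} (xy : x ~ y) {p p′} (Fp : Far xy p) (Fp′ : Far xy p′) (pp′ : p ~ p′)
      {p₁ p₂ a b} (F₁ : Far xy p₁) (F₂ : Far xy p₂) (pp₁ : p ≁ p₁) (pp₂ : p ≁ p₂)
      (xa : x ~ a) (yb : y ~ b) (p₁a : p₁ ~ a) (p₂b : p₂ ~ b) where
      open FarEdge xy Fp Fp′ pp′

      ~p′ : ∀ {r} → Far xy r → p ≁ r → r ~ p′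
      ~p′ Fr pr = far-complete Fr Fp′ pr pp′

      p′≁ : ∀ {u} → x ~ u → u ≁ p′
      p′≁ {u} xu = ¬~⇒≁ λ up′ → touching x F₁ Fp′ pp₁ pp′ (a , xa , p₁a) (u , xu , flip up′)

      p′≁ʸ : ∀ {u} → y ~ u → u ≁ p′
      p′≁ʸ {u} yu = ¬~⇒≁ λ up′ → touching y F₂ Fp′ pp₂ pp′ (b , yb , p₂b) (u , yu , flip up′)

      -- Otherwise the edges xu and vp′, with b isolated, form P₁ + 2P₂.
      complete-touching : ∀ {u r v w} → x ~ u → Far xy r → p ≁ r → r ~ u →
                          Far xy v → p ≁ v → x ~ w → v ~ w → u ~ v
      complete-touching xu Fr pr ru Fv pv xw vw = ¬≁⇒~ λ uv →
        no-P₁+2P₂ xu (~p′ Fv pv) (proj₁ Fv) (proj₁ Fp′) uv (p′≁ xu)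
          (flip (share (flip xy) yb)) (¬~⇒≁ λ bu → pentagon (flip ru) (~p′ Fr pr) (flip (~p′ F₂ pp₂)) p₂b bu)
          (¬~⇒≁ λ bv → not-both-touch xy (_ , xw , vw) (b , yb , flip bv)) (p′≁ʸ yb)

      -- By `complete-touching`, p₁ tells whether u has far neighbours on the side of p₁, and a
      -- tells whether v on that side touches x.
      x-far : ∀ {u v} → x ~ u → Far xy v → e u v ≡ e p₁ u ∧ e a v
      x-far {u} {v} xu Fv with edge? p v
      ... | inj₁ pv rewrite ¬~⇒≁ {a} {v} (λ av → touching x F₁ Fv pp₁ pv (a , xa , p₁a) (a , xa , flip av)) =
        trans (¬~⇒≁ λ uv → touching x F₁ Fv pp₁ pv (a , xa , p₁a) (u , xu , flip uv)) (sym (∧-zeroʳ (e p₁ u)))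
      ... | inj₂ pv with e p₁ u in p₁u | e a v in av
      ...   | true  | true  = complete-touching xu F₁ pp₁ p₁u Fv pv xa (flip av)
      ...   | true  | false = ¬~⇒≁ λ uv →
        clash (complete-touching xa F₁ pp₁ p₁a Fv pv xu (flip uv)) av
      ...   | false | _     = ¬~⇒≁ λ uv →
        clash (flip (complete-touching xu Fv pv (flip uv) F₁ pp₁ xa p₁a)) p₁u

      x-y : ∀ {u v} → x ~ u → y ~ v → p₁ ≁ u → u ~ v
      x-y xu yv p₁u = ¬≁⇒~ λ uv → no-P₁+2P₂ xu (~p′ F₁ pp₁) (proj₁ F₁) (proj₁ Fp′) (flip p₁u) (p′≁ xu)
        (flip (share (flip xy) yv)) (flip uv)
        (¬~⇒≁ λ vp₁ → not-both-touch xy (a , xa , p₁a) (_ , yv , flip vp₁)) (p′≁ʸ yv)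

    module Heptagon {x y} (xy : x ~ y) {p p′} (Fp : Far xy p) (Fp′ : Far xy p′) (pp′ : p ~ p′)
      {p₁ p₂ a b} (F₁ : Far xy p₁) (F₂ : Far xy p₂) (pp₁ : p ≁ p₁) (pp₂ : p ≁ p₂)
      (xa : x ~ a) (yb : y ~ b) (p₁a : p₁ ~ a) (p₂b : p₂ ~ b) where
      open FarEdge xy Fp Fp′ pp′
      private
        swap : ∀ {v} → Far xy v → Far (flip xy) v
        swap (xv , yv) = yv , xv
        module X = HalfHeptagon xy Fp Fp′ pp′ F₁ F₂ pp₁ pp₂ xa yb p₁a p₂b
        module Y = HalfHeptagon (flip xy) (swap Fp) (swap Fp′) pp′ (swap F₂) (swap F₁) pp₂ pp₁ yb xa p₂b p₁a

      refs : Vec (Fin n) 7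
      refs = x ∷ y ∷ p ∷ a ∷ b ∷ p₁ ∷ p₂ ∷ []

      rule : Vec Bool 7 → Vec Bool 7 → Bool
      rule (sx ∷ sy ∷ sp ∷ sa ∷ sb ∷ s₁ ∷ s₂ ∷ []) (tx ∷ ty ∷ tp ∷ ta ∷ tb ∷ t₁ ∷ t₂ ∷ []) =
        if sx then (if tx then false else if ty then not (s₁ ∧ t₂) else s₁ ∧ ta) else
        if sy then (if tx then not (t₁ ∧ s₂) else if ty then false else s₂ ∧ tb) else
        (if tx then t₁ ∧ sa else if ty then t₂ ∧ sb else sp xor tp)

      x-y-rule : ∀ {u v} → x ~ u → y ~ v → e u v ≡ not (e p₁ u ∧ e p₂ v)
      x-y-rule {u} {v} xu yv with e p₁ u in p₁u | e p₂ v in p₂v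
      ... | true  | true  = ¬~⇒≁ λ uv →
        pentagon (flip p₁u) (X.~p′ F₁ pp₁) (flip (X.~p′ F₂ pp₂)) p₂v (flip uv)
      ... | false | _     = X.x-y xu yv p₁u
      ... | true  | false = flip (Y.x-y yv xu p₂v)

      far-rule : ∀ {u v} → Far xy u → Far xy v → e u v ≡ e p u xor e p v
      far-rule {u} {v} Fu Fv with e p u in pu | e p v in pv
      ... | true  | true  = share pu pv
      ... | false | false = far-independent Fu Fv (trans pu (sym pv))
      ... | false | true  = far-complete Fu Fv pu pv
      ... | true  | false = flip (far-complete Fv Fu pv pu)

      heptagon-built : Typed 𝒢 7
      heptagon-built = bits e refs , homogeneous (λ _ → yes tt) rule (λ {u} {v} _ _ _ → cross u v)
        where
        cross : ∀ u v → e u v ≡ rule (bits e refs u) (bits e refs v)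
        cross u v with position xy u | position xy v
        ... | at-x xu _  | at-x xv _  rewrite xu | xv           = share xu xv
        ... | at-x xu _  | at-y xv yv rewrite xu | xv | yv      = x-y-rule xu yv
        ... | at-x xu _  | far (xv , yv) rewrite xu | xv | yv   = X.x-far xu (xv , yv)
        ... | at-y xu yu | at-x xv _  rewrite xu | yu | xv      = flip (x-y-rule xv yu)
        ... | at-y xu yu | at-y xv yv rewrite xu | yu | xv | yv = share yu yv
        ... | at-y xu yu | far (xv , yv) rewrite xu | yu | xv | yv = Y.x-far yu (yv , xv)
        ... | far (xu , yu) | at-x xv _  rewrite xu | yu | xv   = flip (X.x-far xv (xu , yu))
        ... | far (xu , yu) | at-y xv yv rewrite xu | yu | xv | yv = flip (Y.x-far yv (yu , xu))
        ... | far (xu , yu) | far (xv , yv) rewrite xu | yu | xv | yv = far-rule (xu , yu) (xv , yv)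

    module _ {x y} (xy : x ~ y) where

      odd-girth-built : Typed 𝒢 1 ⊎ Typed 𝒢 7
      odd-girth-built with any? (λ p → any? (λ p′ → far? xy p ×-dec far? xy p′ ×-dec p ~? p′))
      -- Far vertices are pairwise non-adjacent here, so each takes a colour permitted by what it
      -- touches.
      ... | no none = inj₁ (bipartite xy (λ v → not (does (touches? xy v x)))
              (λ Fu Fv _ → ¬~⇒≁ λ uv → none (_ , _ , Fu , Fv , uv)) untouched touched)
        where
        untouched : ∀ {v} → Far xy v → not (does (touches? xy v x)) ≡ true → ¬ Touches xy v x
        untouched {v} _ eq t with () ← trans (sym eq) (cong not (dec-true (touches? xy v x) t))
        touched : ∀ {v} → Far xy v → not (does (touches? xy v x)) ≡ false → ¬ Touches xy v y
        touched {v} _ eq ty with touches? xy v x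
        ... | yes tx = not-both-touch xy tx ty
        touched {v} _ () ty | no _
      -- Each of x and y is touched from at most one side of the far graph. The same side for both
      -- gives the 7-cycle; otherwise the two sides extend the colouring.
      ... | yes (p , p′ , Fp , Fp′ , pp′) = cases (touch? false x) (touch? false y) (touch? true x) (touch? true y)
        where
        open FarEdge xy Fp Fp′ pp′
        Touch : Bool → Fin n → Set
        Touch s z = ∃ λ v → Far xy v × e p v ≡ s × Touches xy v z
        touch? : ∀ s z → Dec (Touch s z)
        touch? s z = any? (λ v → far? xy v ×-dec (e p v ≟ᵇ s) ×-dec touches? xy v z)
        not-both-sides : ∀ z → Touch false z → Touch true z → ⊥
        not-both-sides z (u , Fu , pu , tu) (v , Fv , pv , tv) = touching z Fu Fv pu pv tu tv
        straight : ¬ Touch true x → ¬ Touch false y → Typed 𝒢 1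
        straight ¬tx ¬fy = bipartite xy (e p) far-independent
          (λ Fv pv t → ¬tx (_ , Fv , pv , t)) (λ Fv pv t → ¬fy (_ , Fv , pv , t))
        crossed : ¬ Touch false x → ¬ Touch true y → Typed 𝒢 1
        crossed ¬fx ¬ty = bipartite xy (λ v → not (e p v)) (λ Fu Fv eq → far-independent Fu Fv (not-injective eq))
          (λ Fv pv t → ¬fx (_ , Fv , not-injective pv , t)) (λ Fv pv t → ¬ty (_ , Fv , not-injective pv , t))
        cases : Dec (Touch false x) → Dec (Touch false y) → Dec (Touch true x) → Dec (Touch true y) →
                Typed 𝒢 1 ⊎ Typed 𝒢 7
        cases (yes (p₁ , F₁ , pp₁ , a , xa , p₁a)) (yes (p₂ , F₂ , pp₂ , b , yb , p₂b)) _ _ =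
          inj₂ (Heptagon.heptagon-built xy Fp Fp′ pp′ F₁ F₂ pp₁ pp₂ xa yb p₁a p₂b)
        cases _ _ (yes (p₁ , F₁ , pp₁ , a , xa , p₁a)) (yes (p₂ , F₂ , pp₂ , b , yb , p₂b)) =
          -- p and p′ exchange roles, so that p₁ and p₂ again miss the first of them.
          inj₂ (Heptagon.heptagon-built xy Fp′ Fp (flip pp′) F₁ F₂
                 (share pp′ pp₁) (share pp′ pp₂) xa yb p₁a p₂b)
        cases (no ¬fx) _ _ (no ¬ty) = inj₁ (crossed ¬fx ¬ty)
        cases _ (no ¬fy) (no ¬tx) _ = inj₁ (straight ¬tx ¬fy)
        cases (yes fx) _ (yes tx) _ = ⊥-elim (not-both-sides x fx tx)
        cases _ (yes fy) _ (yes ty) = ⊥-elim (not-both-sides y fy ty)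

  decompose : ∃ λ m → m ≤ 15 × Typed 𝒢 m
  decompose with any? (λ x → any? (λ y → x ~? y))
  ... | no none = 0 , ≤ᵇ⇒≤ 0 15 tt , (λ _ → []) ,
    homogeneous (λ _ → yes tt) (λ _ _ → false) (λ _ _ _ → ¬~⇒≁ λ uv → none (_ , _ , uv))
  ... | yes (x₀ , y₀ , x₀y₀) with any? (λ x → any? (λ y → any? (λ z → x ~? y ×-dec x ~? z ×-dec y ~? z)))
  ...   | no ¬K₃ = cases (any? (λ a → any? (λ b → any? (λ c → any? (λ d → any? (λ f →
                     a ~? b ×-dec b ~? c ×-dec c ~? d ×-dec d ~? f ×-dec f ~? a))))))
    where
    no-K₃ : ∀ {a b c} → a ~ b → a ~ c → b ~ c → ⊥
    no-K₃ ab ac bc = ¬K₃ (_ , _ , _ , ab , ac , bc)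
    cases : Dec (∃ λ a → ∃ λ b → ∃ λ c → ∃ λ d → ∃ λ f → a ~ b × b ~ c × c ~ d × d ~ f × f ~ a) →
            ∃ λ m → m ≤ 15 × Typed 𝒢 m
    cases (yes (_ , _ , _ , _ , _ , ab , bc , cd , df , fa)) = 5 , ≤ᵇ⇒≤ 5 15 tt ,
      TriangleFree.five-cycle-built 𝒢 no-K₃
        (record { e₀₁ = ab ; e₁₂ = bc ; e₂₃ = cd ; e₃₄ = df ; e₄₀ = fa })
    cases (no ¬C₅) = [ (λ t → 1 , ≤ᵇ⇒≤ 1 15 tt , t) , (λ t → 7 , ≤ᵇ⇒≤ 7 15 tt , t) ]′
      (OddGirth.odd-girth-built no-K₃
        (λ c → let open C₅ c in ¬C₅ (_ , _ , _ , _ , _ , e₀₁ , e₁₂ , e₂₃ , e₃₄ , e₄₀)) x₀y₀)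
  ...   | yes (x , y , z , xy , xz , yz)
    with any? (λ a → any? (λ b → any? (λ c → any? (λ d →
           a ~? b ×-dec a ~? c ×-dec a ~? d ×-dec b ~? c ×-dec b ~? d ×-dec c ~? d))))
  ...     | no ¬K₄ = [ (λ t → 15 , ≤ᵇ⇒≤ 15 15 tt , t) , (λ t → 12 , ≤ᵇ⇒≤ 12 15 tt , t) ]′
              (ThreeClique.triangle-built 𝒢
                (λ ab ac ad bc bd cd → ¬K₄ (_ , _ , _ , _ , ab , ac , ad , bc , bd , cd)) q clique)
    where
    q : Fin 3 → Fin n
    q = lookup (x ∷ y ∷ z ∷ [])
    clique : ∀ {i j} → i ≢ j → q i ~ q j
    clique {0F} {0F} ne = ⊥-elim (ne refl)
    clique {0F} {1F} _ = xy
    clique {0F} {2F} _ = xz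
    clique {1F} {0F} _ = flip xy
    clique {1F} {1F} ne = ⊥-elim (ne refl)
    clique {1F} {2F} _ = yz
    clique {2F} {0F} _ = flip xz
    clique {2F} {1F} _ = flip yz
    clique {2F} {2F} ne = ⊥-elim (ne refl)
  ...     | yes (a , b , c , d , ab , ac , ad , bc , bd , cd)
    with any? (λ f → a ~? f ×-dec b ~? f ×-dec c ~? f ×-dec d ~? f)
  ...       | yes (f , af , bf , cf , df) = 2 , ≤ᵇ⇒≤ 2 15 tt ,
    LargeClique.large-clique-built 𝒢 ab ac ad af bc bd bf cd cf df
  ...       | no ¬K₅ = 14 , ≤ᵇ⇒≤ 14 15 tt , FourClique.four-clique-built 𝒢 q clique
    (λ v~q → ¬K₅ (_ , flip (v~q 0F) , flip (v~q 1F) , flip (v~q 2F) , flip (v~q 3F)))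
    where
    q : Fin 4 → Fin n
    q = lookup (a ∷ b ∷ c ∷ d ∷ [])
    clique : ∀ {i j} → i ≢ j → q i ~ q j
    clique {0F} {0F} ne = ⊥-elim (ne refl)
    clique {0F} {1F} _ = ab
    clique {0F} {2F} _ = ac
    clique {0F} {3F} _ = ad
    clique {1F} {0F} _ = flip ab
    clique {1F} {1F} ne = ⊥-elim (ne refl)
    clique {1F} {2F} _ = bc
    clique {1F} {3F} _ = bd
    clique {2F} {0F} _ = flip ac
    clique {2F} {1F} _ = flip bc
    clique {2F} {2F} ne = ⊥-elim (ne refl)
    clique {2F} {3F} _ = cd
    clique {3F} {0F} _ = flip ad
    clique {3F} {1F} _ = flip bd
    clique {3F} {2F} _ = flip cd
    clique {3F} {3F} ne = ⊥-elim (ne refl)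

-- The theorem

bit : Bool → Fin 2
bit false = 0F
bit true  = 1F

encode : ∀ {m} → Vec Bool m → Fin (2 ^ m)
encode []       = 0F
encode (b ∷ bs) = combine (bit b) (encode bs)

decode : ∀ {m} → Fin (2 ^ m) → Vec Bool m
decode {ℕ.zero} _ = []
decode {suc m}  i = does (proj₁ (remQuot {2} (2 ^ m) i) ≟ 1F) ∷ decode (proj₂ (remQuot {2} (2 ^ m) i))

decode-encode : ∀ {m} (bs : Vec Bool m) → decode (encode bs) ≡ bs
decode-encode []       = refl
decode-encode (b ∷ bs) = trans
  (cong (λ (i , j) → does (i ≟ 1F) ∷ decode j) (remQuot-combine (bit b) (encode bs)))
  (cong₂ _∷_ (bit-is-one b) (decode-encode bs))
  where
  bit-is-one : ∀ b → does (bit b ≟ 1F) ≡ b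
  bit-is-one false = refl
  bit-is-one true  = refl

does-⇔ : ∀ {P Q : Set} (P? : Dec P) (Q? : Dec Q) → does P? ≡ does Q? → P ⇔ Q
does-⇔ (yes p) (yes q) _ = mk⇔ (λ _ → q) (λ _ → p)
does-⇔ (no ¬p) (no ¬q) _ = mk⇔ (⊥-elim ∘ ¬p) (⊥-elim ∘ ¬q)

module _ {m n} (H : Graph m) (G : Graph n) (f : Fin m → Fin n)
         (match : ∀ u v → does (adj? G (f u) (f v)) ≡ does (adj? H u v)) where

  -- Vertices with different neighbourhoods cannot have the same image.
  induced : (∀ u v → u ≡ v ⊎ (∃ λ w → does (adj? H u w) ≢ does (adj? H v w)) ⊎ f u ≢ f v) → H ⊑ G
  induced separated = f , injective′ , λ u v → does-⇔ (adj? H u v) (adj? G (f u) (f v)) (sym (match u v))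
    where
    injective′ : Injective _≡_ _≡_ f
    injective′ {u} {v} eq with separated u v
    ... | inj₁ u≡v            = u≡v
    ... | inj₂ (inj₁ (w , ne)) = ⊥-elim (ne (trans (sym (match u w))
                                  (trans (cong (λ x → does (adj? G x (f w))) eq) (match v w))))
    ... | inj₂ (inj₂ ne)      = ⊥-elim (ne eq)

module _ {n} (G : Graph n) (free : ⟨ diamond , P₁+2P₂ ⟩-Free G) where

  private
    e : Fin n → Fin n → Bool
    e u v = does (adj? G u v)

    e-sym : ∀ u v → e u v ≡ e v u
    e-sym u v with adj? G u v
    ... | yes uv = sym (dec-true (adj? G v u) (adj-sym G uv))
    ... | no ¬uv = sym (dec-false (adj? G v u) (¬uv ∘ adj-sym G))

    e-irr : ∀ v → e v v ≡ false
    e-irr v = dec-false (adj? G v v) (adj-irr G)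

    flip : ∀ {u v b} → e u v ≡ b → e v u ≡ b
    flip {u} {v} = trans (e-sym v u)

    P₁+2P₂-distinct : ∀ u v → u ≡ v ⊎ (∃ λ w → does (adj? P₁+2P₂ u w) ≢ does (adj? P₁+2P₂ v w))
    P₁+2P₂-distinct = from-yes (all? λ u → all? λ v →
      (u ≟ v) ⊎-dec any? (λ w → ¬? (does (adj? P₁+2P₂ u w) ≟ᵇ does (adj? P₁+2P₂ v w))))

    no-P₁+2P₂ : ∀ {p a b c d} → e a b ≡ true → e c d ≡ true →
                e a c ≡ false → e a d ≡ false → e b c ≡ false → e b d ≡ false →
                e p a ≡ false → e p b ≡ false → e p c ≡ false → e p d ≡ false → ⊥
    no-P₁+2P₂ {p} {a} {b} {c} {d} ab cd ac ad bc bd pa pb pc pd =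
      proj₂ free (induced P₁+2P₂ G f match λ u v → [ inj₁ , inj₂ ∘ inj₁ ]′ (P₁+2P₂-distinct u v))
      where
      f : Fin 5 → Fin n
      f = lookup (p ∷ a ∷ b ∷ c ∷ d ∷ [])
      match : ∀ u v → e (f u) (f v) ≡ does (adj? P₁+2P₂ u v)
      match 0F 0F = e-irr p
      match 0F 1F = pa
      match 0F 2F = pb
      match 0F 3F = pc
      match 0F 4F = pd
      match 1F 0F = flip pa
      match 1F 1F = e-irr a
      match 1F 2F = ab
      match 1F 3F = ac
      match 1F 4F = ad
      match 2F 0F = flip pb
      match 2F 1F = flip ab
      match 2F 2F = e-irr b
      match 2F 3F = bc
      match 2F 4F = bd
      match 3F 0F = flip pc
      match 3F 1F = flip ac
      match 3F 2F = flip bc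
      match 3F 3F = e-irr c
      match 3F 4F = cd
      match 4F 0F = flip pd
      match 4F 1F = flip ad
      match 4F 2F = flip bd
      match 4F 3F = flip cd
      match 4F 4F = e-irr d

    -- The ends of the missing edge have equal neighbourhoods in the diamond, so the distinctness of
    -- their images has to come from w ≢ z.
    diamond-distinct : ∀ u v → u ≡ v ⊎ (∃ λ w → does (adj? diamond u w) ≢ does (adj? diamond v w)) ⊎
                       Between 0F 1F u v
    diamond-distinct = from-yes (all? λ u → all? λ v →
      (u ≟ v) ⊎-dec any? (λ w → ¬? (does (adj? diamond u w) ≟ᵇ does (adj? diamond v w))) ⊎-dec
      ((u ≟ 0F ×-dec v ≟ 1F) ⊎-dec (u ≟ 1F ×-dec v ≟ 0F)))

    no-diamond : ∀ {u v w z} → e u v ≡ true → e u w ≡ true → e v w ≡ true →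
                 e u z ≡ true → e v z ≡ true → w ≢ z → e w z ≡ true
    no-diamond {u} {v} {w} {z} uv uw vw uz vz w≢z with e w z in wz
    ... | true  = refl
    ... | false = ⊥-elim (proj₁ free (induced diamond G f match λ i j → separate i j (diamond-distinct i j)))
      where
      f : Fin 4 → Fin n
      f = lookup (w ∷ z ∷ u ∷ v ∷ [])
      match : ∀ i j → e (f i) (f j) ≡ does (adj? diamond i j)
      match 0F 0F = e-irr w
      match 0F 1F = wz
      match 0F 2F = flip uw
      match 0F 3F = flip vw
      match 1F 0F = flip wz
      match 1F 1F = e-irr z
      match 1F 2F = flip uz
      match 1F 3F = flip vz
      match 2F 0F = uw
      match 2F 1F = uz
      match 2F 2F = e-irr u
      match 2F 3F = uv
      match 3F 0F = vw
      match 3F 1F = vz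
      match 3F 2F = flip uv
      match 3F 3F = e-irr v
      separate : ∀ i j → i ≡ j ⊎ (∃ λ k → does (adj? diamond i k) ≢ does (adj? diamond j k)) ⊎ Between 0F 1F i j →
                 i ≡ j ⊎ (∃ λ k → does (adj? diamond i k) ≢ does (adj? diamond j k)) ⊎ f i ≢ f j
      separate i j (inj₁ eq)                          = inj₁ eq
      separate i j (inj₂ (inj₁ ne))                   = inj₂ (inj₁ ne)
      separate i j (inj₂ (inj₂ (inj₁ (refl , refl)))) = inj₂ (inj₂ w≢z)
      separate i j (inj₂ (inj₂ (inj₂ (refl , refl)))) = inj₂ (inj₂ (w≢z ∘ sym))

  toFree : Free n
  toFree = record { e = e ; e-sym = e-sym ; e-irr = e-irr
                  ; no-P₁+2P₂ = no-P₁+2P₂ ; no-diamond = no-diamond }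

  typed-constructible : ∀ {m} → Fin n → Typed toFree m → ConstructibleWith (2 ^ m + 2 ^ m) G
  typed-constructible v (τ , built)
    -- The 2 ^ m possible vectors become labels, and `realise` doubles their number.
    with realise e e-sym e-irr (refine decode (λ {u} _ → sym (decode-encode (τ u))) built)
  ... | inj₁ none = ⊥-elim (none {v} tt)
  ... | inj₂ R = size , graphₗ , constructible ,
      mk↔ₛ′ index vertex (λ i → injective (vertex-index (vertex i))) vertex-index ,
      λ u w → does-⇔ʳ u w
    where
    open Realised R
    index : Fin n → Fin size
    index u = proj₁ (complete′ {u} tt)
    vertex-index : ∀ u → vertex (index u) ≡ u
    vertex-index u = proj₂ (complete′ {u} tt)
    does-⇔ʳ : ∀ u w → Adj G u w ⇔ Adj (graph graphₗ) (index u) (index w)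
    does-⇔ʳ u w = mk⇔
      (λ uw → Equivalence.from (adjacent (index u) (index w))
        (trans (cong₂ e (vertex-index u) (vertex-index w)) (dec-true (adj? G u w) uw)))
      (λ uw → adj-of (trans (sym (cong₂ e (vertex-index u) (vertex-index w)))
        (Equivalence.to (adjacent (index u) (index w)) uw)))
      where
      adj-of : e u w ≡ true → Adj G u w
      adj-of eq with adj? G u w
      ... | yes uw = uw
      adj-of () | no _

-- Stated for a variable k because Agda would evaluate 2 ^ 15 in unary.
typed-bounded : ∀ k →
  (∀ {n} (G : Graph n) (free : ⟨ diamond , P₁+2P₂ ⟩-Free G) → ∃ λ m → m ≤ k × Typed (toFree G free) m) →
  BoundedCliqueWidth ⟨ diamond , P₁+2P₂ ⟩-Free
typed-bounded k types = 2 ^ k + 2 ^ k , λ { {suc n} G free →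
  let m , m≤k , typed = types G free
  in 2 ^ m + 2 ^ m , +-mono-≤ (^-monoʳ-≤ 2 m≤k) (^-monoʳ-≤ 2 m≤k) , typed-constructible G free 0F typed }

theorem4 : BoundedCliqueWidth ⟨ diamond , P₁+2P₂ ⟩-Free
theorem4 = typed-bounded 15 (λ G free → decompose (toFree G free))
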